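{- Let $\mathbf{p}_n$ be a permutation of $[n]$ chosen uniformly at random. Then $$\lim_{n\to\infty}\Pr\big[\mathbf{p}_n \text{ contains a pair of twins of length at least } \tfrac{1}{80}n^{2/3}\big]=1.$$
   Context: A permutation of a finite set $\Sigma\subset\mathbb{N}$ is a sequence in which every element of $\Sigma$ appears exactly once; a subpermutation of a permutation is a subsequence of it. Two sequences $(a_1,\dots,a_L)$ and $(b_1,\dots,b_L)$ of distinct numbers are order-isomorphic if for all $i,j$: $a_i<a_j \iff b_i<b_j$. Two subpermutations of a permutation are called twins if they are order-isomorphic and disjoint (share no symbol); their length is their common number of entries. -}

module Defs where

open import Data.Empty using (⊥-elim)
open import Data.Fin using (Fin)
import Data.Fin.Properties as Fin
open import Data.Integer using (+_)
open import Data.List using (List; []; _∷_; [_]; _++_; length; map; concatMap; filter; upTo)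
open import Data.List.Membership.Propositional using (_∈_; _∉_; find; lose)
open import Data.List.Membership.Propositional.Properties
  using (∈-map⁺; ∈-map⁻; ∈-++⁺ˡ; ∈-++⁺ʳ; ∈-concatMap⁺; ∈-concatMap⁻; ∈-∃++)
open import Data.List.Properties using (∷-injectiveˡ; ∷-injectiveʳ)
open import Data.List.Relation.Binary.Disjoint.Propositional using (Disjoint)
open import Data.List.Relation.Binary.Permutation.Propositional
  using (_↭_; ↭-refl; ↭-sym; ↭-trans; prep; swap)
open import Data.List.Relation.Binary.Permutation.Propositional.Properties
  using (↭-empty-inv; ∈-resp-↭; drop-mid)
open import Data.List.Relation.Binary.Sublist.Heterogeneous.Properties using (length-mono-≤)
open import Data.List.Relation.Binary.Sublist.Propositional using (_⊆_; []; _∷_; _∷ʳ_)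
open import Data.List.Relation.Unary.All as All using (All; []; _∷_)
open import Data.List.Relation.Unary.AllPairs using ([]; _∷_)
open import Data.List.Relation.Unary.Any using (Any; here; there; any?)
open import Data.List.Relation.Unary.Unique.Propositional using (Unique)
import Data.List.Relation.Unary.Unique.Propositional.Properties as Unique
open import Data.Nat using (ℕ; zero; suc; _≤_; _<_; _<?_; s≤s; NonZero)
import Data.Nat.Properties as ℕ
open import Data.Product using (∃-syntax; _×_; _,_; uncurry)
open import Data.Rational as ℚ using (ℚ; 0ℚ; _/_; _-_; ∣_∣)
open import Data.Vec using (Vec; []; _∷_; lookup; toList)
open import Data.Vec.Properties using (length-toList)
open import Function using (_⇔_; mk⇔; Equivalence; _∘_)
open import Level using (0ℓ)
open import Relation.Binary.PropositionalEquality using (_≡_; _≢_; refl; sym; cong; cong₂; subst)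
open import Relation.Nullary using (Dec; yes; no)
open import Relation.Nullary.Decidable using (map′; _×-dec_; _→-dec_)
open import Relation.Unary using (Pred; Decidable)
open import Data.List.Relation.Binary.Disjoint.DecPropositional ℕ._≟_ using (disjoint?)
open import Data.List.Relation.Binary.Sublist.DecPropositional ℕ._≟_ using (_⊆?_)

private
  variable
    A : Set

-- Convergence of a rational sequence.  Testing against positive rational ε
-- only is equivalent to testing against all positive real ε.
infix 4 _⟶_

_⟶_ : (ℕ → ℚ) → ℚ → Set
f ⟶ l = ∀ ε → 0ℚ ℚ.< ε → ∃[ N ] (∀ n → N ≤ n → ∣ f n - l ∣ ℚ.< ε)

insertions : A → List A → List (List A)
insertions x []       = [ [ x ] ]
insertions x (y ∷ ys) = (x ∷ y ∷ ys) ∷ map (y ∷_) (insertions x ys)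

-- By ∈-permutations⇔↭ and permutations-unique below, for a repetition-free
-- list xs this lists each arrangement of the entries of xs exactly once.
permutations : List A → List (List A)
permutations []       = [ [] ]
permutations (x ∷ xs) = concatMap (insertions x) (permutations xs)

private
  insertions-sound : ∀ (x : A) ys {zs} → zs ∈ insertions x ys → zs ↭ x ∷ ys
  insertions-sound x []       (here refl) = ↭-refl
  insertions-sound x (y ∷ ys) (here refl) = ↭-refl
  insertions-sound x (y ∷ ys) (there zs∈) with ∈-map⁻ (y ∷_) zs∈
  ... | ws , ws∈ , refl = ↭-trans (prep y (insertions-sound x ys ws∈)) (swap y x ↭-refl)

  insertions-complete : ∀ (x : A) us vs → us ++ x ∷ vs ∈ insertions x (us ++ vs)
  insertions-complete x []       []       = here refl
  insertions-complete x []       (v ∷ vs) = here refl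
  insertions-complete x (u ∷ us) vs       = there (∈-map⁺ (u ∷_) (insertions-complete x us vs))

  insertions-unique : ∀ (x : A) ys → x ∉ ys → Unique (insertions x ys)
  insertions-unique x []       x∉ = [] ∷ []
  insertions-unique x (y ∷ ys) x∉ =
    All.tabulate head≢ ∷ Unique.map⁺ ∷-injectiveʳ (insertions-unique x ys (x∉ ∘ there))
    where
    head≢ : ∀ {zs} → zs ∈ map (y ∷_) (insertions x ys) → x ∷ y ∷ ys ≢ zs
    head≢ zs∈ eq with ∈-map⁻ (y ∷_) zs∈
    ... | _ , _ , refl = x∉ (here (∷-injectiveˡ eq))

  insertions-injective : ∀ (x : A) ys ys′ {zs} → x ∉ ys → x ∉ ys′ →
                         zs ∈ insertions x ys → zs ∈ insertions x ys′ → ys ≡ ys′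
  insertions-injective x [] [] _ _ _ _ = refl
  insertions-injective x [] (y′ ∷ ys′) _ x∉′ (here refl) (there q) with ∈-map⁻ (y′ ∷_) q
  ... | _ , _ , refl = ⊥-elim (x∉′ (here refl))
  insertions-injective x (y ∷ ys) [] x∉ _ (there p) (here refl) with ∈-map⁻ (y ∷_) p
  ... | _ , _ , refl = ⊥-elim (x∉ (here refl))
  insertions-injective x (y ∷ ys) (y′ ∷ ys′) _ _ (here refl) (here eq) = ∷-injectiveʳ eq
  insertions-injective x (y ∷ ys) (y′ ∷ ys′) _ x∉′ (here refl) (there q) with ∈-map⁻ (y′ ∷_) q
  ... | _ , _ , refl = ⊥-elim (x∉′ (here refl))
  insertions-injective x (y ∷ ys) (y′ ∷ ys′) x∉ _ (there p) (here refl) with ∈-map⁻ (y ∷_) p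
  ... | _ , _ , refl = ⊥-elim (x∉ (here refl))
  insertions-injective x (y ∷ ys) (y′ ∷ ys′) x∉ x∉′ (there p) (there q)
    with ∈-map⁻ (y ∷_) p | ∈-map⁻ (y′ ∷_) q
  ... | ws , ws∈ , refl | ws′ , ws′∈ , eq =
    cong₂ _∷_ (∷-injectiveˡ eq)
      (insertions-injective x ys ys′ (x∉ ∘ there) (x∉′ ∘ there) ws∈
        (subst (_∈ insertions x ys′) (sym (∷-injectiveʳ eq)) ws′∈))

  permutations-sound : ∀ (xs : List A) {p} → p ∈ permutations xs → p ↭ xs
  permutations-sound []       (here refl) = ↭-refl
  permutations-sound (x ∷ xs) p∈
    with find (∈-concatMap⁻ (insertions x) {xs = permutations xs} p∈)
  ... | q , q∈ , p∈q = ↭-trans (insertions-sound x q p∈q) (prep x (permutations-sound xs q∈))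

  permutations-complete : ∀ (xs : List A) {p} → p ↭ xs → p ∈ permutations xs
  permutations-complete []       p↭ with ↭-empty-inv p↭
  ... | refl = here refl
  permutations-complete (x ∷ xs) p↭ with ∈-∃++ (∈-resp-↭ (↭-sym p↭) (here refl))
  ... | us , vs , refl =
    ∈-concatMap⁺ (insertions x)
      (lose (permutations-complete xs (drop-mid us [] p↭)) (insertions-complete x us vs))

  ∉⁺ : ∀ {x : A} {xs} → All (x ≢_) xs → x ∉ xs
  ∉⁺ x≢ x∈ = All.lookup x≢ x∈ refl

  concatMap-unique : ∀ {B : Set} (f : A → List B) {xs} → Unique xs →
    (∀ {x} → x ∈ xs → Unique (f x)) →
    (∀ {x y z} → x ∈ xs → y ∈ xs → z ∈ f x → z ∈ f y → x ≡ y) →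
    Unique (concatMap f xs)
  concatMap-unique f []        uf inj = []
  concatMap-unique f (x≢ ∷ ux) uf inj =
    Unique.++⁺ (uf (here refl))
      (concatMap-unique f ux (uf ∘ there) (λ x∈ y∈ → inj (there x∈) (there y∈)))
      λ (z∈ , z∈′) → let y , y∈ , z∈y = find (∈-concatMap⁻ f z∈′) in
        All.lookup x≢ y∈ (inj (here refl) (there y∈) z∈ z∈y)

∈-permutations⇔↭ : ∀ (xs : List A) {p} → p ∈ permutations xs ⇔ (p ↭ xs)
∈-permutations⇔↭ xs = mk⇔ (permutations-sound xs) (permutations-complete xs)

permutations-unique : ∀ {xs : List A} → Unique xs → Unique (permutations xs)
permutations-unique []                      = [] ∷ []
permutations-unique (_∷_ {x} {xs} x≢ uniq) =
  concatMap-unique (insertions x) (permutations-unique uniq)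
    (λ q∈ → insertions-unique x _ (x∉ q∈))
    (λ q∈ q′∈ → insertions-injective x _ _ (x∉ q∈) (x∉ q′∈))
  where
  x∉ : ∀ {q} → q ∈ permutations xs → x ∉ q
  x∉ q∈ x∈q = ∉⁺ x≢ (∈-resp-↭ (permutations-sound xs q∈) x∈q)

permutations-nonEmpty : ∀ (xs : List A) → NonZero (length (permutations xs))
permutations-nonEmpty xs = ∈⇒nonZero (permutations-complete xs ↭-refl)
  where
  ∈⇒nonZero : ∀ {B : Set} {y : B} {ys} → y ∈ ys → NonZero (length ys)
  ∈⇒nonZero (here _)  = _
  ∈⇒nonZero (there _) = _

[1⋯_] : ℕ → List ℕ
[1⋯ n ] = map suc (upTo n)

[1⋯_]-unique : ∀ n → Unique [1⋯ n ]
[1⋯ n ]-unique = Unique.map⁺ ℕ.suc-injective (Unique.upTo⁺ n)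

-- The probability of the event P for a uniformly random permutation of
-- {1,…,n}: the proportion of permutations that satisfy P.
Pr : ∀ n {P : Pred (List ℕ) 0ℓ} → Decidable P → ℚ
Pr n P? = + length (filter P? 𝕊) / length 𝕊
  where
  𝕊 = permutations [1⋯ n ]
  instance
    𝕊-nonEmpty : NonZero (length 𝕊)
    𝕊-nonEmpty = permutations-nonEmpty [1⋯ n ]

OrderIsomorphic : ∀ {L} → Vec ℕ L → Vec ℕ L → Set
OrderIsomorphic a b = ∀ i j → lookup a i < lookup a j ⇔ lookup b i < lookup b j

-- _⊆_ is the (not necessarily contiguous) subsequence relation.
record Twins (p : List ℕ) {L : ℕ} (a b : Vec ℕ L) : Set where
  constructor mkTwins
  field
    subpermutationˡ : toList a ⊆ p
    subpermutationʳ : toList b ⊆ p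
    orderIsomorphic : OrderIsomorphic a b
    disjoint        : Disjoint (toList a) (toList b)

-- Contains twins of some length satisfying Q.
ContainsTwinsOfLength : Pred ℕ 0ℓ → List ℕ → Set
ContainsTwinsOfLength Q p = ∃[ L ] Q L × ∃[ a ] ∃[ b ] Twins p {L} a b

private
  subsequences : ∀ L → List A → List (Vec A L)
  subsequences zero    _        = [ [] ]
  subsequences (suc L) []       = []
  subsequences (suc L) (x ∷ xs) = map (x ∷_) (subsequences L xs) ++ subsequences (suc L) xs

  subsequences-complete : ∀ {L} (v : Vec A L) {xs} → toList v ⊆ xs → v ∈ subsequences L xs
  subsequences-complete []      _ = here refl
  subsequences-complete (x ∷ v) {y ∷ ys} (.y ∷ʳ v⊆) =
    ∈-++⁺ʳ (map (y ∷_) (subsequences _ ys)) (subsequences-complete (x ∷ v) v⊆)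
  subsequences-complete (x ∷ v) (refl ∷ v⊆) =
    ∈-++⁺ˡ (∈-map⁺ (x ∷_) (subsequences-complete v v⊆))

  orderIsomorphic? : ∀ {L} (a b : Vec ℕ L) → Dec (OrderIsomorphic a b)
  orderIsomorphic? a b = Fin.all? λ i → Fin.all? λ j →
    map′ (uncurry mk⇔) (λ e → Equivalence.to e , Equivalence.from e)
      (((lookup a i <? lookup a j) →-dec (lookup b i <? lookup b j)) ×-dec
       ((lookup b i <? lookup b j) →-dec (lookup a i <? lookup a j)))

  twins? : ∀ p {L} (a b : Vec ℕ L) → Dec (Twins p a b)
  twins? p a b with toList a ⊆? p | toList b ⊆? p | orderIsomorphic? a b | disjoint? (toList a) (toList b)
  ... | yes s | yes t | yes o | yes d = yes (mkTwins s t o d)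
  ... | no ¬s | _     | _     | _     = no (¬s ∘ Twins.subpermutationˡ)
  ... | _     | no ¬t | _     | _     = no (¬t ∘ Twins.subpermutationʳ)
  ... | _     | _     | no ¬o | _     = no λ t → ¬o (Twins.orderIsomorphic t)
  ... | _     | _     | _     | no ¬d = no λ t → ¬d (Twins.disjoint t)

  ∃twins? : ∀ p L → Dec (∃[ a ] ∃[ b ] Twins p {L} a b)
  ∃twins? p L = map′ to from (any? (λ a → any? (twins? p a) ss) ss)
    where
    ss = subsequences L p
    to : Any (λ a → Any (Twins p a) ss) ss → _
    to h = let a , _ , h′ = find h ; b , _ , t = find h′ in a , b , t
    from : _ → Any (λ a → Any (Twins p a) ss) ss
    from (a , b , t) =
      lose (subsequences-complete a (Twins.subpermutationˡ t))
        (lose (subsequences-complete b (Twins.subpermutationʳ t)) t)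

containsTwinsOfLength? : ∀ {Q : Pred ℕ 0ℓ} → Decidable Q → Decidable (ContainsTwinsOfLength Q)
containsTwinsOfLength? Q? p =
  map′ (λ (L , _ , h) → L , h) bound
    (ℕ.anyUpTo? (λ L → Q? L ×-dec ∃twins? p L) (suc (length p)))
  where
  bound : _ → _
  bound (L , q , a , b , t) =
    L , s≤s (subst (_≤ length p) (length-toList a) (length-mono-≤ (Twins.subpermutationˡ t)))
      , q , a , b , t

{-# OPTIONS --safe #-}

module Submission where

-- A uniformly random permutation arises by inserting n, n - 1, …, 1 one after another, each into a
-- uniformly random slot.  Cut the list present before the last T = Θ(n) insertions into Θ(n^(2/3))
-- segments of length Θ(n^(1/3)); afterwards segments only grow, so each of them is always hit with
-- probability Ω(n^(-2/3)).  Whenever a segment is hit for the second time since the last completed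
-- pair, the two inserted entries form a new pair and the segment is retired.  Pairs lie in disjoint
-- position intervals and in disjoint value intervals, so their larger and their smaller entries are
-- twins.  Completing a pair takes about n^(1/3) insertions, as in the birthday problem, and
-- the exponential moment of the number of missing pairs shows that Ω(n^(2/3)) pairs are completed
-- with probability tending to 1.  To keep the moment bound linear, at most K = Θ(n^(1/3)) segments are
-- open at any time.

import Algebra.Properties.CommutativeSemigroup as CommutativeSemigroup
open import Data.Empty using (⊥; ⊥-elim)
open import Data.Fin using (zero; suc)
open import Data.Integer as ℤ using (ℤ; -[1+_]; +[1+_]) renaming (+_ to pos)
import Data.Integer.Properties as ℤ
import Data.Integer.Tactic.RingSolver as ℤSolver
open import Data.List using (List; []; _∷_; [_]; _++_; length; map; concatMap; filter; applyUpTo; take; drop)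
open import Data.List.Membership.Propositional using (_∈_; find)
open import Data.List.Membership.Propositional.Properties using (∈-map⁻; ∈-concatMap⁻)
open import Data.List.Properties
  using (map-id; map-++; map-∘; length-++; length-map; length-take; length-drop; length-filter;
         filter-++; filter-none; concatMap-++; concatMap-pure; take++drop≡id; drop-drop)
open import Data.List.Relation.Binary.Permutation.Propositional.Properties using (↭-length)
open import Data.List.Relation.Binary.Sublist.Heterogeneous.Properties using (length-mono-≤)
open import Data.List.Relation.Binary.Sublist.Propositional
  using (_⊆_; []; _∷_; _∷ʳ_; ⊆-refl; ⊆-trans; lookup; from∈; minimum)
open import Data.List.Relation.Binary.Sublist.Propositional.Properties using (++⁺; ++⁺ˡ)
open import Data.List.Relation.Unary.All as All using (All; []; _∷_)
import Data.List.Relation.Unary.All.Properties as All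
open import Data.List.Relation.Unary.AllPairs as AllPairs using (AllPairs; []; _∷_)
import Data.List.Relation.Unary.AllPairs.Properties as AllPairs
open import Data.List.Relation.Unary.Any using (here; there)
open import Data.Nat
open import Data.Nat.ListAction using (sum)
open import Data.Nat.ListAction.Properties using (sum-++)
open import Data.Nat.Properties
open import Data.Nat.Tactic.RingSolver using (solve-∀)
open import Data.Product using (∃-syntax; _×_; _,_; proj₁; proj₂)
open import Data.Rational as ℚ using (mkℚ; 0ℚ; 1ℚ; toℚᵘ)
import Data.Rational.Properties as ℚ
open import Data.Rational.Unnormalised as ℚᵘ using (ℚᵘ; mkℚᵘ; 1ℚᵘ; *<*)
import Data.Rational.Unnormalised.Properties as ℚᵘ
open import Data.Sum using (_⊎_; inj₁; inj₂; swap)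
open import Data.Unit using (⊤)
import Data.Vec as Vec
import Data.Vec.Properties as Vec
open import Function using (_∘_; id; _on_; Equivalence; mk⇔)
open import Level using (0ℓ)
open import Relation.Binary.PropositionalEquality using (_≡_; refl; sym; trans; cong; cong₂; subst; subst₂)
open import Relation.Nullary using (¬?; yes; no)
open import Relation.Nullary.Decidable using (toWitness)
open import Relation.Unary using (Pred; Decidable)
open import Defs

open CommutativeSemigroup +-commutativeSemigroup using (interchange) renaming (x∙yz≈y∙xz to +-exchange)
open CommutativeSemigroup *-commutativeSemigroup using () renaming (x∙yz≈y∙xz to *-exchange)

private
  variable
    A : Set

-- Estimates

-- With `g` good and `x` bad outcomes the distance to 1 is `x / t`. A positive rational is at least
-- one over its denominator, so `x * ℚ.↧ₙ ε < t` suffices.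
ratio-near-1 : ∀ g x t .{{_ : NonZero t}} ε → 0ℚ ℚ.< ε → g + x ≡ t → x * ℚ.↧ₙ ε < t →
               ℚ.∣ (pos g ℚ./ t) ℚ.- 1ℚ ∣ ℚ.< ε
ratio-near-1 g x (suc t) ε@(mkℚ +[1+ a ] b _) _ g+x≡t xb<t =
  ℚ.toℚᵘ-cancel-< (ℚᵘ.<-respˡ-≃ (ℚᵘ.≃-sym ≃-distance) (*<* (begin-strict
    pos ℤ.∣ num ∣ ℤ.* +[1+ b ]        ≡⟨ cong (λ z → pos ℤ.∣ z ∣ ℤ.* +[1+ b ]) num≡ ⟩
    pos ℤ.∣ ℤ.- pos x ∣ ℤ.* +[1+ b ]  ≡⟨ cong (λ z → pos z ℤ.* +[1+ b ]) (ℤ.∣-i∣≡∣i∣ (pos x)) ⟩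
    pos x ℤ.* +[1+ b ]                ≡⟨ ℤ.pos-* x (suc b) ⟨
    pos (x * suc b)                   <⟨ ℤ.+<+ xb<t ⟩
    +[1+ t ]                          ≤⟨ ℤ.+≤+ (≤-trans (≤-reflexive (sym (*-identityʳ (suc t))))
                                                        (m≤n*m (suc t * 1) (suc a))) ⟩
    pos (suc a * (suc t * 1))         ≡⟨ ℤ.pos-* (suc a) (suc t * 1) ⟩
    +[1+ a ] ℤ.* pos (suc t * 1)      ∎)))
  where
  open ℤ.≤-Reasoning
  distance : ℚᵘ
  distance = ℚᵘ.∣ mkℚᵘ (pos g) t ℚᵘ.+ (ℚᵘ.- 1ℚᵘ) ∣
  num : ℤ
  num = pos g ℤ.* pos 1 ℤ.+ -[1+ 0 ] ℤ.* +[1+ t ]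
  cancel : ∀ i j → i ℤ.* pos 1 ℤ.+ -[1+ 0 ] ℤ.* (i ℤ.+ j) ≡ ℤ.- j
  cancel = ℤSolver.solve-∀
  num≡ : num ≡ ℤ.- pos x
  num≡ = trans (cong (λ z → pos g ℤ.* pos 1 ℤ.+ -[1+ 0 ] ℤ.* z) (trans (cong pos (sym g+x≡t)) (ℤ.pos-+ g x)))
               (cancel (pos g) (pos x))
  ≃-distance : toℚᵘ ℚ.∣ (pos g ℚ./ suc t) ℚ.- 1ℚ ∣ ℚᵘ.≃ distance
  ≃-distance = ℚᵘ.≃-trans (ℚ.toℚᵘ-homo-∣-∣ ((pos g ℚ./ suc t) ℚ.- 1ℚ))
    (ℚᵘ.∣-∣-cong (ℚᵘ.≃-trans (ℚ.toℚᵘ-homo-+ (pos g ℚ./ suc t) (ℚ.- 1ℚ))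
      (ℚᵘ.+-congˡ _ (ℚ.toℚᵘ-fromℚᵘ (mkℚᵘ (pos g) t)))))
ratio-near-1 g x (suc t) (mkℚ (pos 0) _ _)  (ℚ.*<* (ℤ.+<+ ())) _ _
ratio-near-1 g x (suc t) (mkℚ -[1+ _ ] _ _) (ℚ.*<* ()) _ _

open ≤-Reasoning

-- The product of `N + i ∸ c` over i = 1, ..., k. For `c = 0` it counts the ways to make `k`
-- insertions into a list of length `N`; in general, its quotient by that count is the product of
-- the decay factors 1 - c / (N + i), truncated at 0.
rising : ℕ → ℕ → ℕ → ℕ
rising c zero    N = 1
rising c (suc k) N = (suc N ∸ c) * rising c k (suc N)

-- In fractions, 1 - c/x ≤ 1 - c/n ≤ 1 / (1 + c/n). The last bound is the same for all `x`, so
-- products of such factors become powers.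
factor-compare : ∀ {n x} c → x ≤ n → (x ∸ c) * (n + c) ≤ x * n
factor-compare {n} {x} c x≤n with ≤-total x c
... | inj₁ x≤c rewrite m≤n⇒m∸n≡0 x≤c = z≤n
... | inj₂ c≤x = begin
  y * (n + c)   ≡⟨ *-distribˡ-+ y n c ⟩
  y * n + y * c ≤⟨ +-monoʳ-≤ (y * n) (*-monoˡ-≤ c (≤-trans (m∸n≤m x c) x≤n)) ⟩
  y * n + n * c ≡⟨ solve y n c ⟩
  (y + c) * n   ≡⟨ cong (_* n) (m∸n+n≡m c≤x) ⟩
  x * n         ∎
  where
  y = x ∸ c
  solve : ∀ y n c → y * n + n * c ≡ (y + c) * n
  solve = solve-∀

rising-compare : ∀ {n} c k N → N + k ≤ n → rising c k N * (n + c) ^ k ≤ rising 0 k N * n ^ k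
rising-compare         c zero    N _ = ≤-refl
rising-compare {n} c (suc k) N N+k≤n = begin
  ((suc N ∸ c) * R) * ((n + c) * (n + c) ^ k)   ≡⟨ [m*n]*[o*p]≡[m*o]*[n*p] (suc N ∸ c) R (n + c) ((n + c) ^ k) ⟩
  ((suc N ∸ c) * (n + c)) * (R * (n + c) ^ k)   ≤⟨ *-mono-≤ (factor-compare c (m+n≤o⇒m≤o (suc N) N+k<n))
                                                    (rising-compare c k (suc N) N+k<n) ⟩
  (suc N * n) * (rising 0 k (suc N) * n ^ k)    ≡⟨ [m*n]*[o*p]≡[m*o]*[n*p] (suc N) n (rising 0 k (suc N)) (n ^ k) ⟩
  (suc N * rising 0 k (suc N)) * (n * n ^ k)    ∎
  where
  R = rising c k (suc N)
  N+k<n : suc N + k ≤ n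
  N+k<n = subst (_≤ n) (+-suc N k) N+k≤n

bernoulli : ∀ n c t → n ^ t * (n + t * c) ≤ n * (n + c) ^ t
bernoulli n c zero    = ≤-reflexive (lemma n)
  where
  lemma : ∀ n → 1 * (n + 0) ≡ n * 1
  lemma = solve-∀
bernoulli n c (suc t) = begin
  n * n ^ t * (n + suc t * c)                     ≤⟨ m≤m+n _ (n ^ t * (t * (c * c))) ⟩
  n * n ^ t * (n + suc t * c) + n ^ t * (t * (c * c)) ≡⟨ lemma n c t (n ^ t) ⟩
  n ^ t * (n + t * c) * (n + c)                   ≤⟨ *-monoˡ-≤ (n + c) (bernoulli n c t) ⟩
  n * (n + c) ^ t * (n + c)                       ≡⟨ *-assoc n _ _ ⟩
  n * ((n + c) ^ t * (n + c))                     ≡⟨ cong (n *_) (*-comm ((n + c) ^ t) (n + c)) ⟩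
  n * ((n + c) * (n + c) ^ t)                     ∎
  where
  lemma : ∀ n c t x → n * x * (n + suc t * c) + x * (t * (c * c)) ≡ x * (n + t * c) * (n + c)
  lemma = solve-∀

^-distribʳ-* : ∀ k m n → (m * n) ^ k ≡ m ^ k * n ^ k
^-distribʳ-* zero    m n = refl
^-distribʳ-* (suc k) m n = trans (cong (m * n *_) (^-distribʳ-* k m n)) ([m*n]*[o*p]≡[m*o]*[n*p] m n (m ^ k) (n ^ k))

-- By Bernoulli, a block of `t` insertions gains a factor (1 + c/n)^t ≥ 1 + 3 = 4, and there are `ℓ`
-- blocks. This 4 per block outweighs the 2 per missing pair in the initial potential.
rising-gain : ∀ {n} .{{_ : NonZero n}} c t ℓ N → N + t * ℓ ≤ n → 3 * n ≤ t * c →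
              rising c (t * ℓ) N * 4 ^ ℓ ≤ rising 0 (t * ℓ) N
rising-gain {n} c t ℓ N N+k≤n 3n≤tc = *-cancelʳ-≤ _ _ (n ^ k) {{m^n≢0 n k}} (begin
  R * 4 ^ ℓ * n ^ k      ≡⟨ *-assoc R (4 ^ ℓ) (n ^ k) ⟩
  R * (4 ^ ℓ * n ^ k)    ≡⟨ cong (λ x → R * (4 ^ ℓ * x)) (^-*-assoc n t ℓ) ⟨
  R * (4 ^ ℓ * (n ^ t) ^ ℓ) ≡⟨ cong (R *_) (^-distribʳ-* ℓ 4 (n ^ t)) ⟨
  R * (4 * n ^ t) ^ ℓ    ≤⟨ *-monoʳ-≤ R (^-monoˡ-≤ ℓ four) ⟩
  R * ((n + c) ^ t) ^ ℓ  ≡⟨ cong (R *_) (^-*-assoc (n + c) t ℓ) ⟩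
  R * (n + c) ^ k        ≤⟨ rising-compare c k N N+k≤n ⟩
  rising 0 k N * n ^ k   ∎)
  where
  k = t * ℓ
  R = rising c k N
  lemma : ∀ n x → n * (4 * x) ≡ x * (n + 3 * n)
  lemma = solve-∀
  four : 4 * n ^ t ≤ (n + c) ^ t
  four = *-cancelˡ-≤ n (begin
    n * (4 * n ^ t)      ≡⟨ lemma n (n ^ t) ⟩
    n ^ t * (n + 3 * n)  ≤⟨ *-monoʳ-≤ (n ^ t) (+-monoʳ-≤ n 3n≤tc) ⟩
    n ^ t * (n + t * c)  ≤⟨ bernoulli n c t ⟩
    n * (n + c) ^ t      ∎)

n<2^n : ∀ n → n < 2 ^ n
n<2^n zero    = s≤s z≤n
n<2^n (suc n) = begin
  suc (suc n)    ≤⟨ +-mono-≤ {1} (m^n>0 2 n) (n<2^n n) ⟩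
  2 ^ n + 2 ^ n  ≡⟨ cong (2 ^ n +_) (+-identityʳ (2 ^ n)) ⟨
  2 * 2 ^ n      ∎

-- The ratio `x / t` is at most 2 / 2^(q²), where 2^(q²) > q² ≥ q ≥ 4b.
small-ratio : ∀ x t b q .{{_ : NonZero t}} .{{_ : NonZero q}} → 4 * b ≤ q → x * 2 ^ (q * q) ≤ 2 * t → x * b < t
small-ratio x t b q 4b≤q few = *-cancelˡ-< 4 (x * b) t (begin-strict
  4 * (x * b)      ≡⟨ *-exchange 4 x b ⟩
  x * (4 * b)      ≤⟨ *-monoʳ-≤ x 4b≤q ⟩
  x * q            ≤⟨ *-monoʳ-≤ x (≤-trans (m≤m*n q q) (<⇒≤ (n<2^n (q * q)))) ⟩
  x * 2 ^ (q * q)  ≤⟨ few ⟩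
  2 * t            <⟨ *-monoˡ-< t {2} {4} (s≤s (s≤s (s≤s z≤n))) ⟩
  4 * t            ∎)

cube-scale : ∀ d .{{_ : NonZero d}} q₀ n → (d * q₀) ^ 3 ≤ n →
             ∃[ q ] q₀ ≤ q × (d * q) ^ 3 ≤ n × n ≤ (d * suc q) ^ 3
cube-scale d q₀ n lo with m≤n⇒m<n∨m≡n lo
... | inj₂ refl = q₀ , ≤-refl , ≤-refl , ^-monoˡ-≤ 3 (*-monoʳ-≤ d (n≤1+n q₀))
cube-scale d q₀ (suc n) lo | inj₁ (s≤s lo′) with cube-scale d q₀ n lo′
... | q , q₀≤q , l , u with m≤n⇒m<n∨m≡n u
...   | inj₁ n<   = q , q₀≤q , m≤n⇒m≤1+n l , n<
-- Here `n` has reached the upper bound, so its successor is covered by the next `q`.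
...   | inj₂ refl = suc q , m≤n⇒m≤1+n q₀≤q , n≤1+n _ , ^-monoˡ-< 3 (*-monoʳ-< d (n<1+n (suc q)))

square-step : ∀ {q} → 20 ≤ q → 4 * (suc q * suc q) ≤ 5 * (q * q)
square-step {q} 20≤q = begin
  4 * (suc q * suc q)          ≡⟨ lemma₁ q ⟩
  4 * (q * q) + (8 * q + 4 * 1)
    ≤⟨ +-monoʳ-≤ (4 * (q * q)) (+-monoʳ-≤ (8 * q) (*-monoʳ-≤ 4 (≤-trans (s≤s z≤n) 20≤q))) ⟩
  4 * (q * q) + (8 * q + 4 * q) ≡⟨ lemma₂ q ⟩
  12 * q + 4 * (q * q)         ≤⟨ +-monoˡ-≤ (4 * (q * q)) (*-monoˡ-≤ q (m+n≤o⇒m≤o 12 {8} 20≤q)) ⟩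
  5 * (q * q)                  ∎
  where
  lemma₁ : ∀ q → 4 * (suc q * suc q) ≡ 4 * (q * q) + (8 * q + 4 * 1)
  lemma₁ = solve-∀
  lemma₂ : ∀ q → 4 * (q * q) + (8 * q + 4 * q) ≡ 12 * q + 4 * (q * q)
  lemma₂ = solve-∀

cube-step : ∀ {q} → 20 ≤ q → 3 * (suc q * suc q * suc q) ≤ 4 * (q * q * q)
cube-step {q} 20≤q = begin
  3 * (suc q * suc q * suc q)                    ≡⟨ lemma₁ q ⟩
  3 * (q * q * q) + 3 * q + 3 * 1 + (6 * q + 9 * (q * q))
    ≤⟨ +-monoˡ-≤ (6 * q + 9 * (q * q)) (+-monoʳ-≤ (3 * (q * q * q) + 3 * q) (*-monoʳ-≤ 3 (≤-trans (s≤s z≤n) 20≤q))) ⟩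
  3 * (q * q * q) + 3 * q + 3 * q + (6 * q + 9 * (q * q)) ≡⟨ lemma₂ q ⟩
  12 * q + (9 * (q * q) + 3 * (q * q * q))       ≤⟨ +-monoˡ-≤ _ (*-monoˡ-≤ q (m+n≤o⇒m≤o 12 {8} 20≤q)) ⟩
  q * q + (9 * (q * q) + 3 * (q * q * q))        ≡⟨ lemma₃ q ⟩
  10 * (q * q) + 3 * (q * q * q)                 ≤⟨ +-monoˡ-≤ _ (*-monoˡ-≤ (q * q) (m+n≤o⇒m≤o 10 {10} 20≤q)) ⟩
  q * (q * q) + 3 * (q * q * q)                  ≡⟨ cong (_+ 3 * (q * q * q)) (*-assoc q q q) ⟨
  4 * (q * q * q)                                ∎
  where
  lemma₁ : ∀ q → 3 * (suc q * suc q * suc q) ≡ 3 * (q * q * q) + 3 * q + 3 * 1 + (6 * q + 9 * (q * q))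
  lemma₁ = solve-∀
  lemma₂ : ∀ q → 3 * (q * q * q) + 3 * q + 3 * q + (6 * q + 9 * (q * q)) ≡ 12 * q + (9 * (q * q) + 3 * (q * q * q))
  lemma₂ = solve-∀
  lemma₃ : ∀ q → q * q + (9 * (q * q) + 3 * (q * q * q)) ≡ 10 * (q * q) + 3 * (q * q * q)
  lemma₃ = solve-∀

-- The source of 1/80: n^(2/3) ≤ 64 (q + 1)² ≤ 64 · 5/4 · q² = 80 q². Everything is cubed to stay
-- within ℕ.
length-enough : ∀ {n q} → 20 ≤ q → n ≤ (8 * suc q) ^ 3 → n ^ 2 ≤ (80 * (q * q)) ^ 3
length-enough {n} {q} 20≤q n≤ = begin
  n ^ 2                        ≤⟨ ^-monoˡ-≤ 2 n≤ ⟩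
  ((8 * suc q) ^ 3) ^ 2        ≡⟨ trans (^-*-assoc (8 * suc q) 3 2) (sym (^-*-assoc (8 * suc q) 2 3)) ⟩
  ((8 * suc q) ^ 2) ^ 3        ≡⟨ cong (_^ 3) (lemma₁ (suc q)) ⟩
  (16 * (4 * (suc q * suc q))) ^ 3 ≤⟨ ^-monoˡ-≤ 3 (*-monoʳ-≤ 16 (square-step 20≤q)) ⟩
  (16 * (5 * (q * q))) ^ 3     ≡⟨ cong (_^ 3) (*-assoc 16 5 (q * q)) ⟨
  (80 * (q * q)) ^ 3           ∎
  where
  lemma₁ : ∀ u → 8 * u * (8 * u * 1) ≡ 16 * (4 * (u * u))
  lemma₁ = solve-∀

-- The right-hand side is 2048 q³ = 4 (8q)³, and `cube-step` bounds n / (8q)³ by 4/3.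
steps-enough : ∀ {n q} → 20 ≤ q → n ≤ (8 * suc q) ^ 3 → 3 * n ≤ 256 * q * (8 * (q * q))
steps-enough {n} {q} 20≤q n≤ = begin
  3 * n                               ≤⟨ *-monoʳ-≤ 3 n≤ ⟩
  3 * (8 * suc q) ^ 3                 ≡⟨ lemma₁ (suc q) ⟩
  512 * (3 * (suc q * suc q * suc q)) ≤⟨ *-monoʳ-≤ 512 (cube-step 20≤q) ⟩
  512 * (4 * (q * q * q))             ≡⟨ lemma₂ q ⟩
  256 * q * (8 * (q * q))             ∎
  where
  lemma₁ : ∀ u → 3 * (8 * u * (8 * u * (8 * u * 1))) ≡ 512 * (3 * (u * u * u))
  lemma₁ = solve-∀
  lemma₂ : ∀ q → 512 * (4 * (q * q * q)) ≡ 256 * q * (8 * (q * q))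
  lemma₂ = solve-∀

-- In units of q³, segments take 136 and later insertions 256 out of 512; the remaining 120 absorb
-- the lower-order term 32 q².
room-enough : ∀ {n q} .{{_ : NonZero q}} → (8 * q) ^ 3 ≤ n →
              (16 * (q * q) + (4 * q + q * q)) * (8 * q) + 256 * q * (q * q) ≤ n
room-enough {n} {q} ≤n = begin
  (16 * (q * q) + (4 * q + q * q)) * (8 * q) + 256 * q * (q * q) ≡⟨ lemma₁ q ⟩
  392 * (q * q * q) + 32 * (q * q)
    ≤⟨ +-monoʳ-≤ (392 * (q * q * q)) (*-mono-≤ {32} {120} (toWitness {a? = 32 ≤? 120} _) (m≤m*n (q * q) q)) ⟩
  392 * (q * q * q) + 120 * (q * q * q) ≡⟨ lemma₂ q ⟩
  (8 * q) ^ 3                           ≤⟨ ≤n ⟩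
  n                                     ∎
  where
  lemma₁ : ∀ q → (16 * (q * q) + (4 * q + q * q)) * (8 * q) + 256 * q * (q * q) ≡ 392 * (q * q * q) + 32 * (q * q)
  lemma₁ = solve-∀
  lemma₂ : ∀ q → 392 * (q * q * q) + 120 * (q * q * q) ≡ 8 * q * (8 * q * (8 * q * 1))
  lemma₂ = solve-∀

-- Twins from pairs

-- For pairs with b < a: the intervals [b , a] and [b′ , a′] are disjoint.
Apart : ℕ × ℕ → ℕ × ℕ → Set
Apart (a , b) (a′ , b′) = a < b′ ⊎ a′ < b

-- `AllPairs` relates earlier entries to later ones only; symmetry covers i > j and leaves i = j as
-- the exception.
lookup-AllPairs : ∀ {R : A → A → Set} (xs : List A) → (∀ {x y} → R x y → R y x) → AllPairs R xs →
                  ∀ i j → i ≡ j ⊎ R (Vec.lookup (Vec.fromList xs) i) (Vec.lookup (Vec.fromList xs) j)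
lookup-AllPairs (x ∷ xs) s (_ ∷ _)  zero    zero    = inj₁ refl
lookup-AllPairs {R = R} (x ∷ xs) s (r ∷ _)  zero    (suc j) = inj₂ (lookup-All xs r j)
  where
  lookup-All : ∀ ys → All (R x) ys → ∀ j → R x (Vec.lookup (Vec.fromList ys) j)
  lookup-All (y ∷ ys) (p ∷ ps) zero    = p
  lookup-All (y ∷ ys) (p ∷ ps) (suc j) = lookup-All ys ps j
lookup-AllPairs (x ∷ xs) s (r ∷ rs) (suc i) zero    with lookup-AllPairs (x ∷ xs) s (r ∷ rs) zero (suc i)
... | inj₂ q = inj₂ (s q)
lookup-AllPairs (x ∷ xs) s (_ ∷ rs) (suc i) (suc j) with lookup-AllPairs xs s rs i j
... | inj₁ refl = inj₁ refl
... | inj₂ q    = inj₂ q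

-- Disjoint intervals are ordered alike by their upper and by their lower ends, which gives the
-- order isomorphism; they share no endpoint, which gives disjointness.
twins-of-pairs : ∀ {p} (ps : List (ℕ × ℕ)) → All (λ (a , b) → b < a) ps → AllPairs Apart ps →
                 map proj₁ ps ⊆ p → map proj₂ ps ⊆ p → ∃[ a ] ∃[ b ] Twins p {length ps} a b
twins-of-pairs {p} ps lt apart ⊆₁ ⊆₂ = as , bs , mkTwins (side proj₁ ⊆₁) (side proj₂ ⊆₂) iso disj
  where
  v  = Vec.fromList ps
  as = Vec.map proj₁ v
  bs = Vec.map proj₂ v
  toList-side : (f : ℕ × ℕ → ℕ) → Vec.toList (Vec.map f v) ≡ map f ps
  toList-side f = trans (Vec.toList-map f v) (cong (map f) (Vec.toList∘fromList ps))
  side : (f : ℕ × ℕ → ℕ) → map f ps ⊆ p → Vec.toList (Vec.map f v) ⊆ p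
  side f = subst (_⊆ p) (sym (toList-side f))
  lookup-lt : ∀ (qs : List (ℕ × ℕ)) → All (λ (a , b) → b < a) qs →
              ∀ i → proj₂ (Vec.lookup (Vec.fromList qs) i) < proj₁ (Vec.lookup (Vec.fromList qs) i)
  lookup-lt (q ∷ qs) (l ∷ ls) zero    = l
  lookup-lt (q ∷ qs) (l ∷ ls) (suc i) = lookup-lt qs ls i
  iso : OrderIsomorphic as bs
  iso i j rewrite Vec.lookup-map i proj₁ v | Vec.lookup-map j proj₁ v
                | Vec.lookup-map i proj₂ v | Vec.lookup-map j proj₂ v
    with lookup-AllPairs ps swap apart i j | lookup-lt ps lt i | lookup-lt ps lt j
  ... | inj₁ refl        | _  | _  = mk⇔ (λ h → ⊥-elim (<-irrefl refl h)) (λ h → ⊥-elim (<-irrefl refl h))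
  ... | inj₂ (inj₁ a<b′) | b<a | b′<a′ = mk⇔ (λ _ → <-trans b<a a<b′) (λ _ → <-trans a<b′ b′<a′)
  ... | inj₂ (inj₂ a′<b) | b<a | b′<a′ =
    mk⇔ (λ h → ⊥-elim (<-asym h (<-trans a′<b b<a))) (λ h → ⊥-elim (<-asym h (<-trans b′<a′ a′<b)))
  clash : ∀ qs → All (λ (a , b) → b < a) qs → AllPairs Apart qs → ∀ {x} → x ∈ map proj₁ qs → x ∈ map proj₂ qs → ⊥
  clash ((a , b) ∷ qs) (l ∷ ls) (r ∷ rs) (here refl) (here eq)   = <-irrefl (sym eq) l
  clash ((a , b) ∷ qs) (l ∷ ls) (r ∷ rs) (there x∈)  (there x∈′) = clash qs ls rs x∈ x∈′
  clash ((a , b) ∷ qs) (l ∷ ls) (r ∷ rs) (here refl) (there x∈)  with ∈-map⁻ proj₂ x∈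
  ... | q , q∈ , refl with All.lookup r q∈
  ...   | inj₁ a<b′ = <-irrefl refl a<b′
  ...   | inj₂ a′<b = <-asym (<-trans (All.lookup ls q∈) a′<b) l
  clash ((a , b) ∷ qs) (l ∷ ls) (r ∷ rs) (there x∈) (here refl)  with ∈-map⁻ proj₁ x∈
  ... | q , q∈ , refl with All.lookup r q∈
  ...   | inj₁ a<b′ = <-asym (<-trans l a<b′) (All.lookup ls q∈)
  ...   | inj₂ a′<b = <-irrefl refl a′<b
  disj : ∀ {x} → x ∈ Vec.toList as × x ∈ Vec.toList bs → ⊥
  disj (x∈ , x∈′) = clash ps lt apart (subst (_ ∈_) (toList-side proj₁) x∈) (subst (_ ∈_) (toList-side proj₂) x∈′)

-- Insertions

-- A slot belongs to the entry that follows it, so in a concatenation the last slot of a block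
-- counts for the next block.
inner : A → List A → List (List A)
inner x []       = []
inner x (y ∷ ys) = (x ∷ y ∷ ys) ∷ map (y ∷_) (inner x ys)

inner-∋ : ∀ {x : A} ys {zs} → zs ∈ inner x ys → x ∈ zs
inner-∋ (y ∷ ys) (here refl) = here refl
inner-∋ (y ∷ ys) (there zs∈) with ∈-map⁻ (y ∷_) zs∈
... | _ , ws∈ , refl = there (inner-∋ ys ws∈)

inner-⊇ : ∀ {x : A} ys {zs} → zs ∈ inner x ys → ys ⊆ zs
inner-⊇ (y ∷ ys) (here refl) = _ ∷ʳ ⊆-refl
inner-⊇ (y ∷ ys) (there zs∈) with ∈-map⁻ (y ∷_) zs∈
... | _ , ws∈ , refl = refl ∷ inner-⊇ ys ws∈

length-inner : ∀ (x : A) ys → length (inner x ys) ≡ length ys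
length-inner x []       = refl
length-inner x (y ∷ ys) = cong suc (trans (length-map (y ∷_) (inner x ys)) (length-inner x ys))

∈-inner-length : ∀ {x : A} ys {zs} → zs ∈ inner x ys → length zs ≡ suc (length ys)
∈-inner-length (y ∷ ys) (here refl) = refl
∈-inner-length (y ∷ ys) (there zs∈) with ∈-map⁻ (y ∷_) zs∈
... | _ , ws∈ , refl = cong suc (∈-inner-length ys ws∈)

insertions-⊇ : ∀ {x : A} ys {zs} → zs ∈ insertions x ys → ys ⊆ zs
insertions-⊇ []       (here refl) = _ ∷ʳ []
insertions-⊇ (y ∷ ys) (here refl) = _ ∷ʳ ⊆-refl
insertions-⊇ (y ∷ ys) (there zs∈) with ∈-map⁻ (y ∷_) zs∈
... | _ , ws∈ , refl = refl ∷ insertions-⊇ ys ws∈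

length-insertions : ∀ (x : A) ys → length (insertions x ys) ≡ suc (length ys)
length-insertions x []       = refl
length-insertions x (y ∷ ys) = cong suc (trans (length-map (y ∷_) (insertions x ys)) (length-insertions x ys))

∈-insertions-length : ∀ {x : A} ys {zs} → zs ∈ insertions x ys → length zs ≡ suc (length ys)
∈-insertions-length []       (here refl) = refl
∈-insertions-length (y ∷ ys) (here refl) = refl
∈-insertions-length (y ∷ ys) (there zs∈) with ∈-map⁻ (y ∷_) zs∈
... | _ , ws∈ , refl = cong suc (∈-insertions-length ys ws∈)

insertions-++ : ∀ (x : A) ys zs →
  insertions x (ys ++ zs) ≡ map (_++ zs) (inner x ys) ++ map (ys ++_) (insertions x zs)
insertions-++ x []       zs = sym (map-id (insertions x zs))
insertions-++ x (y ∷ ys) zs = cong ((x ∷ y ∷ ys ++ zs) ∷_) (trans (cong (map (y ∷_)) (insertions-++ x ys zs))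
  (trans (map-++ (y ∷_) (map (_++ zs) (inner x ys)) _)
    (cong₂ _++_ (trans (sym (map-∘ (inner x ys))) (map-∘ (inner x ys))) (sym (map-∘ (insertions x zs))))))

sum-map-≤ : ∀ (f : A → ℕ) d u ys → (∀ {y} → y ∈ ys → f y + d ≤ u) →
            sum (map f ys) + length ys * d ≤ length ys * u
sum-map-≤ f d u []       h = z≤n
sum-map-≤ f d u (y ∷ ys) h = begin
  f y + sum (map f ys) + (d + length ys * d)   ≡⟨ interchange (f y) (sum (map f ys)) d (length ys * d) ⟩
  (f y + d) + (sum (map f ys) + length ys * d) ≤⟨ +-mono-≤ (h (here refl)) (sum-map-≤ f d u ys (h ∘ there)) ⟩
  u + length ys * u                            ∎

-- Permutations as the outcome of successive insertions

extensions : ℕ → List ℕ → List (List ℕ)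
extensions zero    p = [ p ]
extensions (suc k) p = concatMap (extensions k) (insertions (suc k) p)

extensions-⊇ : ∀ k p {p′} → p′ ∈ extensions k p → p ⊆ p′
extensions-⊇ zero    p (here refl) = ⊆-refl
extensions-⊇ (suc k) p p′∈ with find (∈-concatMap⁻ (extensions k) {xs = insertions (suc k) p} p′∈)
... | q , q∈ , p′∈q = ⊆-trans (insertions-⊇ p q∈) (extensions-⊇ k q p′∈q)

length-concatMap : ∀ {B : Set} (f : A → List B) xs → length (concatMap f xs) ≡ sum (map (length ∘ f) xs)
length-concatMap f []       = refl
length-concatMap f (x ∷ xs) = trans (length-++ (f x)) (cong (length (f x) +_) (length-concatMap f xs))

sum-map-const : ∀ (f : A → ℕ) d ys → (∀ {y} → y ∈ ys → f y ≡ d) → sum (map f ys) ≡ length ys * d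
sum-map-const f d []       h = refl
sum-map-const f d (y ∷ ys) h = cong₂ _+_ (h (here refl)) (sum-map-const f d ys (h ∘ there))

length-extensions : ∀ k p → length (extensions k p) ≡ rising 0 k (length p)
length-extensions zero    p = refl
length-extensions (suc k) p = trans (length-concatMap (extensions k) (insertions (suc k) p))
  (trans (sum-map-const _ (rising 0 k (suc (length p))) (insertions (suc k) p)
      λ {q} q∈ → trans (length-extensions k q) (cong (rising 0 k) (∈-insertions-length p q∈)))
    (cong (_* rising 0 k (suc (length p))) (length-insertions (suc k) p)))

interval : ℕ → ℕ → List ℕ
interval k zero    = []
interval k (suc j) = suc k ∷ interval (suc k) j

length-interval : ∀ k j → length (interval k j) ≡ j
length-interval k zero    = refl
length-interval k (suc j) = cong suc (length-interval (suc k) j)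

[1⋯]-interval : ∀ n → [1⋯ n ] ≡ interval 0 n
[1⋯]-interval n = go n id 0 λ _ → refl
  where
  go : ∀ n f k → (∀ i → f i ≡ k + i) → map suc (applyUpTo f n) ≡ interval k n
  go zero    f k eq = refl
  go (suc n) f k eq = cong₂ _∷_ (cong suc (trans (eq 0) (+-identityʳ k)))
    (go n (f ∘ suc) (suc k) λ i → trans (eq (suc i)) (+-suc k i))

concatMap-concatMap : ∀ {B C : Set} (g : B → List C) (f : A → List B) xs →
                      concatMap g (concatMap f xs) ≡ concatMap (concatMap g ∘ f) xs
concatMap-concatMap g f []       = refl
concatMap-concatMap g f (x ∷ xs) = trans (concatMap-++ g (f x) (concatMap f xs))
  (cong (concatMap g (f x) ++_) (concatMap-concatMap g f xs))

-- `permutations` inserts the head of its list last, so the large values are arranged first and k,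
-- ..., 1 follow. Each induction step moves one value from the base interval to the inserted ones.
permutations-interval : ∀ k j →
  permutations (interval 0 (k + j)) ≡ concatMap (extensions k) (permutations (interval k j))
permutations-interval zero    j = sym (concatMap-pure (permutations (interval 0 j)))
permutations-interval (suc k) j = trans (cong (permutations ∘ interval 0) (sym (+-suc k j)))
  (trans (permutations-interval k (suc j))
    (concatMap-concatMap (extensions k) (insertions (suc k)) (permutations (interval (suc k) j))))

-- Segments

-- opened a: the segment received a after the last pair was completed.
-- used a b: the segment holds the pair {a , b}, where b was inserted after a.
data Status : Set where
  fresh  : Status
  opened : ℕ → Status
  used   : ℕ → ℕ → Status

Segment : Set
Segment = Status × List ℕ

fill : List Segment → List ℕ → List ℕ
fill []             tail = tail
fill ((_ , e) ∷ ss) tail = e ++ fill ss tail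

fill-restatus : ∀ us {st st′ e} vs {tail} → fill (us ++ (st , e) ∷ vs) tail ≡ fill (us ++ (st′ , e) ∷ vs) tail
fill-restatus []            vs = refl
fill-restatus ((_ , e) ∷ us) vs = cong (e ++_) (fill-restatus us vs)

-- Completing a pair discards the pending first hits, all of which exceed the new threshold; thus
-- both values of every later pair lie below it.
reset : Segment → Segment
reset (opened _ , e) = fresh , e
reset (st       , e) = st , e

fill-reset : ∀ ss {tail} → fill (map reset ss) tail ≡ fill ss tail
fill-reset []                   = refl
fill-reset ((fresh , e) ∷ ss)    = cong (e ++_) (fill-reset ss)
fill-reset ((opened _ , e) ∷ ss) = cong (e ++_) (fill-reset ss)
fill-reset ((used _ _ , e) ∷ ss) = cong (e ++_) (fill-reset ss)

Tally : Set
Tally = Status → ℕ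

#fresh #opened #used : Tally
#fresh fresh = 1
#fresh _     = 0
#opened (opened _) = 1
#opened _          = 0
#used (used _ _) = 1
#used _          = 0

tally : Tally → List Segment → ℕ
tally g []             = 0
tally g ((st , _) ∷ ss) = g st + tally g ss

tally-replace : ∀ g us {z z′} vs →
  g (proj₁ z) + tally g (us ++ z′ ∷ vs) ≡ g (proj₁ z′) + tally g (us ++ z ∷ vs)
tally-replace g []              {z} {z′} vs = +-exchange (g (proj₁ z)) (g (proj₁ z′)) (tally g vs)
tally-replace g ((st , _) ∷ us) {z} {z′} vs =
  trans (+-exchange (g (proj₁ z)) (g st) _)
    (trans (cong (g st +_) (tally-replace g us vs)) (+-exchange (g st) (g (proj₁ z′)) _))

length-replace : ∀ (us : List A) {z z′} vs → length (us ++ z ∷ vs) ≡ length (us ++ z′ ∷ vs)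
length-replace []       vs = refl
length-replace (u ∷ us) vs = cong suc (length-replace us vs)

tally-scale : ∀ g d ss → tally (λ st → g st * d) ss ≡ tally g ss * d
tally-scale g d []              = refl
tally-scale g d ((st , _) ∷ ss) =
  trans (cong (g st * d +_) (tally-scale g d ss)) (sym (*-distribʳ-+ d (g st) (tally g ss)))

tally-total : ∀ ss → tally #fresh ss + (tally #opened ss + tally #used ss) ≡ length ss
tally-total []                   = refl
tally-total ((fresh , _) ∷ ss)    = cong suc (tally-total ss)
tally-total ((opened _ , _) ∷ ss) = trans (+-suc _ _) (cong suc (tally-total ss))
tally-total ((used _ _ , _) ∷ ss) =
  trans (cong (tally #fresh ss +_) (+-suc (tally #opened ss) _)) (trans (+-suc _ _) (cong suc (tally-total ss)))

tally-used-reset : ∀ ss → tally #used (map reset ss) ≡ tally #used ss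
tally-used-reset []                   = refl
tally-used-reset ((fresh , _) ∷ ss)    = tally-used-reset ss
tally-used-reset ((opened _ , _) ∷ ss) = tally-used-reset ss
tally-used-reset ((used _ _ , _) ∷ ss) = cong suc (tally-used-reset ss)

tally-opened-reset : ∀ ss → tally #opened (map reset ss) ≡ 0
tally-opened-reset []                   = refl
tally-opened-reset ((fresh , _) ∷ ss)    = tally-opened-reset ss
tally-opened-reset ((opened _ , _) ∷ ss) = tally-opened-reset ss
tally-opened-reset ((used _ _ , _) ∷ ss) = tally-opened-reset ss

All-replace : ∀ {P Q : A → Set} us {z z′} vs → All P (us ++ z ∷ vs) → (∀ {y} → P y → Q y) → (P z → Q z′) →
              All Q (us ++ z′ ∷ vs)
All-replace []       vs (p ∷ ps) f g = g p ∷ All.map f ps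
All-replace (u ∷ us) vs (p ∷ ps) f g = f p ∷ All-replace us vs ps f g

All-middle : ∀ {P : A → Set} us {z} vs → All P (us ++ z ∷ vs) → P z
All-middle []       vs (p ∷ _)  = p
All-middle (u ∷ us) vs (_ ∷ ps) = All-middle us vs ps

AllPairs-replace : ∀ {R : A → A → Set} us {z z′} vs → AllPairs R (us ++ z ∷ vs) →
  All (λ y → (R y z → R y z′) × (R z y → R z′ y)) (us ++ z ∷ vs) → AllPairs R (us ++ z′ ∷ vs)
AllPairs-replace []       vs (r ∷ rs) (_ ∷ hs) = All.zipWith (λ ((_ , f) , x) → f x) (hs , r) ∷ rs
AllPairs-replace (u ∷ us) vs (r ∷ rs) (h ∷ hs) = All-replace us vs r id (proj₁ h) ∷ AllPairs-replace us vs rs hs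

-- gain st is what a hit in a segment of status st saves on the bound Φ.
sum-insertions-≤ : ∀ {x s} segs tail (f : List ℕ → ℕ) (gain : Tally) Φ →
  All (λ seg → s ≤ length (proj₂ seg)) segs →
  (∀ us {st e} vs {e′} → segs ≡ us ++ (st , e) ∷ vs → e′ ∈ inner x e →
    f (fill (us ++ (st , e′) ∷ vs) tail) + gain st ≤ Φ) →
  (∀ {tail′} → tail′ ∈ insertions x tail → f (fill segs tail′) ≤ Φ) →
  sum (map f (insertions x (fill segs tail))) + s * tally gain segs ≤ suc (length (fill segs tail)) * Φ
sum-insertions-≤ {x} {s} [] tail f gain Φ [] hit miss = begin
  sum (map f (insertions x tail)) + s * 0 ≡⟨ cong (sum (map f (insertions x tail)) +_)
                                              (trans (*-zeroʳ s) (sym (*-zeroʳ (length (insertions x tail))))) ⟩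
  sum (map f (insertions x tail)) + length (insertions x tail) * 0
    ≤⟨ sum-map-≤ f 0 Φ (insertions x tail) (λ {y} y∈ → subst (_≤ Φ) (sym (+-identityʳ (f y))) (miss y∈)) ⟩
  length (insertions x tail) * Φ ≡⟨ cong (_* Φ) (length-insertions x tail) ⟩
  suc (length tail) * Φ ∎
sum-insertions-≤ {x} {s} ((st , e) ∷ segs) tail f gain Φ (s≤ ∷ ss≤) hit miss = begin
  sum (map f (insertions x (e ++ rest))) + s * (gain st + tally gain segs)
    ≡⟨ cong₂ _+_ (trans (cong (sum ∘ map f) (insertions-++ x e rest))
         (trans (cong sum (map-++ f (map (_++ rest) (inner x e)) _))
           (trans (sum-++ (map f (map (_++ rest) (inner x e))) _)
             (cong₂ _+_ (cong sum (sym (map-∘ (inner x e)))) (cong sum (sym (map-∘ (insertions x rest))))))))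
         (*-distribˡ-+ s (gain st) _) ⟩
  (S₁ + S₂) + (s * gain st + s * tally gain segs)
    ≡⟨ interchange S₁ S₂ (s * gain st) (s * tally gain segs) ⟩
  (S₁ + s * gain st) + (S₂ + s * tally gain segs)
    -- Whatever it has received so far, a segment has at least `s` slots, and each of them saves
    -- `gain st`.
    ≤⟨ +-monoˡ-≤ _ (+-monoʳ-≤ S₁ (*-monoˡ-≤ (gain st) (≤-trans s≤ (≤-reflexive (sym (length-inner x e)))))) ⟩
  (S₁ + length (inner x e) * gain st) + (S₂ + s * tally gain segs)
    ≤⟨ +-mono-≤ (sum-map-≤ (f ∘ (_++ rest)) (gain st) Φ (inner x e) (hit [] segs refl))
         (sum-insertions-≤ segs tail (f ∘ (e ++_)) gain Φ ss≤
           (λ us vs eq → hit ((st , e) ∷ us) vs (cong ((st , e) ∷_) eq)) miss) ⟩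
  length (inner x e) * Φ + suc (length rest) * Φ
    ≡⟨ cong (λ l → l * Φ + suc (length rest) * Φ) (length-inner x e) ⟩
  length e * Φ + suc (length rest) * Φ
    ≡⟨ *-distribʳ-+ Φ (length e) (suc (length rest)) ⟨
  (length e + suc (length rest)) * Φ
    ≡⟨ cong (_* Φ) (trans (+-suc (length e) _) (cong suc (sym (length-++ e)))) ⟩
  suc (length (e ++ rest)) * Φ ∎
  where
  rest = fill segs tail
  S₁ = sum (map (f ∘ (_++ rest)) (inner x e))
  S₂ = sum (map (f ∘ (e ++_)) (insertions x rest))

-- Values are inserted in decreasing order, k being the next one, and θ is the value that completed
-- the last pair: whatever lies below θ was inserted after that.
data Marked (k θ : ℕ) (e : List ℕ) : Status → Set where
  fresh  : Marked k θ e fresh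
  opened : ∀ {a} → a ∈ e → k < a → a < θ → Marked k θ e (opened a)
  used   : ∀ {a b} → a ∈ e → b ∈ e → b < a → θ ≤ b → Marked k θ e (used a b)

-- Only completed pairs are constrained. An opened segment gets separated from them when it is
-- closed, by means of the threshold `θ`.
Separate : Status → Status → Set
Separate (used a b) (used a′ b′) = Apart (a , b) (a′ , b′)
Separate _ _ = ⊤

pairs : List Segment → List (ℕ × ℕ)
pairs []                    = []
pairs ((used a b , _) ∷ ss) = (a , b) ∷ pairs ss
pairs (_ ∷ ss)              = pairs ss

length-pairs : ∀ ss → length (pairs ss) ≡ tally #used ss
length-pairs []                   = refl
length-pairs ((fresh , _) ∷ ss)    = length-pairs ss
length-pairs ((opened _ , _) ∷ ss) = length-pairs ss
length-pairs ((used _ _ , _) ∷ ss) = cong suc (length-pairs ss)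

Valid : ℕ → ℕ → ℕ → Segment → Set
Valid s k θ (st , e) = s ≤ length e × Marked k θ e st

Marked-mono : ∀ {k θ e e′ st} → e ⊆ e′ → Marked (suc k) θ e st → Marked k θ e′ st
Marked-mono i fresh              = fresh
Marked-mono i (opened a∈ k<a a<θ) = opened (lookup i a∈) (<-trans (n<1+n _) k<a) a<θ
Marked-mono i (used a∈ b∈ l θ≤)  = used (lookup i a∈) (lookup i b∈) l θ≤

pairs-descending : ∀ {s k θ} ss → All (Valid s k θ) ss → All (λ (a , b) → b < a) (pairs ss)
pairs-descending []                    []       = []
pairs-descending ((fresh , _) ∷ ss)    (_ ∷ vs) = pairs-descending ss vs
pairs-descending ((opened _ , _) ∷ ss) (_ ∷ vs) = pairs-descending ss vs
pairs-descending ((used _ _ , _) ∷ ss) ((_ , used _ _ l _) ∷ vs) = l ∷ pairs-descending ss vs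

pairs-apart : ∀ ss → AllPairs (Separate on proj₁) ss → AllPairs Apart (pairs ss)
pairs-apart []                    []       = []
pairs-apart ((fresh , _) ∷ ss)    (_ ∷ rs) = pairs-apart ss rs
pairs-apart ((opened _ , _) ∷ ss) (_ ∷ rs) = pairs-apart ss rs
pairs-apart ((used a b , _) ∷ ss) (r ∷ rs) = go ss r ∷ pairs-apart ss rs
  where
  go : ∀ ss → All (Separate (used a b) ∘ proj₁) ss → All (Apart (a , b)) (pairs ss)
  go []                    []       = []
  go ((fresh , _) ∷ ss)    (_ ∷ rs) = go ss rs
  go ((opened _ , _) ∷ ss) (_ ∷ rs) = go ss rs
  go ((used _ _ , _) ∷ ss) (r ∷ rs) = r ∷ go ss rs

-- Segments are consecutive stretches of the list, so one entry from each used segment yields a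
-- subsequence. `pick` lets one proof serve the larger and the smaller entries, in whichever order
-- they stand within a segment.
pairs-⊆ : ∀ {s k θ tail} (f : ℕ × ℕ → ℕ) →
          (∀ {e a b} → a ∈ e → b ∈ e → f (a , b) ∈ e) →
          ∀ ss → All (Valid s k θ) ss → map f (pairs ss) ⊆ fill ss tail
pairs-⊆ f pick []                    []       = minimum _
pairs-⊆ f pick ((fresh , e) ∷ ss)    (_ ∷ vs) = ++⁺ˡ e (pairs-⊆ f pick ss vs)
pairs-⊆ f pick ((opened _ , e) ∷ ss) (_ ∷ vs) = ++⁺ˡ e (pairs-⊆ f pick ss vs)
pairs-⊆ f pick ((used _ _ , e) ∷ ss) ((_ , used a∈ b∈ _ _) ∷ vs) = ++⁺ (from∈ (pick a∈ b∈)) (pairs-⊆ f pick ss vs)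

Valid-mono : ∀ {s k θ st e e′} → e ⊆ e′ → Valid s (suc k) θ (st , e) → Valid s k θ (st , e′)
Valid-mono i (s≤ , mk) = ≤-trans s≤ (length-mono-≤ i) , Marked-mono i mk

Separate-openedʳ : ∀ st {a} → Separate st (opened a)
Separate-openedʳ fresh      = _
Separate-openedʳ (opened _) = _
Separate-openedʳ (used _ _) = _

cut : ℕ → ℕ → List ℕ → List Segment
cut s zero    xs = []
cut s (suc m) xs = (fresh , take s xs) ∷ cut s m (drop s xs)

fill-cut : ∀ s m xs → fill (cut s m xs) (drop (m * s) xs) ≡ xs
fill-cut s zero    xs = refl
fill-cut s (suc m) xs = trans (cong (take s xs ++_)
    (trans (cong (fill (cut s m (drop s xs))) (sym (drop-drop s (m * s) xs))) (fill-cut s m (drop s xs))))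
  (take++drop≡id s xs)

-- States of the process and their transitions

module Configurations (ℓ m s : ℕ) where

  -- `k` values remain to be inserted, `r` pairs are missing, and `o` segments have been opened
  -- since the last completed pair.
  record Config (k r o : ℕ) (segs : List Segment) : Set where
    constructor config
    field
      θ         : ℕ
      k<θ       : k < θ
      valid     : All (Valid s k θ) segs
      separate  : AllPairs (Separate on proj₁) segs
      length≡   : length segs ≡ m
      opened≡   : tally #opened segs ≡ o
      used≡     : tally #used segs + r ≡ ℓ

  miss : ∀ {k r o segs} → Config (suc k) r o segs → Config k r o segs
  miss (config θ k<θ valid sep l o u) =
    config θ (<-trans (n<1+n _) k<θ) (All.map (Valid-mono ⊆-refl) valid) sep l o u

  -- For hits that change no status: those in a used segment, and those in a fresh one when no more
  -- segments may be opened.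
  keep : ∀ {k r o} us {st e} vs {e′} → Config (suc k) r o (us ++ (st , e) ∷ vs) → e′ ∈ inner (suc k) e →
         Config k r o (us ++ (st , e′) ∷ vs)
  keep us {st} vs (config θ k<θ valid sep l o u) e′∈ =
    config θ (<-trans (n<1+n _) k<θ)
      (All-replace us vs valid (Valid-mono ⊆-refl) (Valid-mono (inner-⊇ _ e′∈)))
      (AllPairs-replace us vs sep (All.universal (λ _ → id , id) _))
      (trans (length-replace us vs) l)
      (trans (+-cancelˡ-≡ (#opened st) _ _ (tally-replace #opened us vs)) o)
      (trans (cong (_+ _) (+-cancelˡ-≡ (#used st) _ _ (tally-replace #used us vs))) u)

  open-segment : ∀ {k r o} us {e} vs {e′} → Config (suc k) r o (us ++ (fresh , e) ∷ vs) → e′ ∈ inner (suc k) e →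
                 Config k r (suc o) (us ++ (opened (suc k) , e′) ∷ vs)
  open-segment {k} us {e} vs {e′} (config θ k<θ valid sep l o u) e′∈ =
    config θ (<-trans (n<1+n _) k<θ)
      (All-replace us vs valid (Valid-mono ⊆-refl)
        λ (s≤ , _) → ≤-trans s≤ (length-mono-≤ (inner-⊇ e e′∈)) , opened (inner-∋ e e′∈) (n<1+n _) k<θ)
      (AllPairs-replace us vs sep (All.universal (λ y → (λ _ → Separate-openedʳ (proj₁ y)) , _) _))
      (trans (length-replace us vs) l)
      (trans (tally-replace #opened us vs) (cong suc o))
      (trans (cong (_+ _) (tally-replace #used us {fresh , e} {opened (suc k) , e′} vs)) u)

  -- The new pair is `a` with `suc k`, and `suc k` becomes the threshold. Earlier pairs have b ≥ θ >
  -- a, so the new interval lies below all of theirs.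
  close-segment : ∀ {k r o a} us {e} vs {e′} → Config (suc k) (suc r) o (us ++ (opened a , e) ∷ vs) →
                  e′ ∈ inner (suc k) e → Config k r 0 (map reset (us ++ (used a (suc k) , e′) ∷ vs))
  close-segment {k} {r} {a = a} us {e} vs {e′} (config θ k<θ valid sep l o u) e′∈
    with All-middle us vs valid
  ... | _ , opened a∈ k<a a<θ =
    config (suc k) (n<1+n k)
      (All.map⁺ (All-replace us vs valid valid-reset
        λ (s≤ , _) → ≤-trans s≤ (length-mono-≤ (inner-⊇ e e′∈)) ,
                     used (lookup (inner-⊇ e e′∈) a∈) (inner-∋ e e′∈) k<a ≤-refl))
      (AllPairs.map⁺ (AllPairs.map (λ {x} {y} → separate-reset x y)
        (AllPairs-replace us vs sep (All.map compatible valid))))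
      (trans (length-map reset (us ++ (used a (suc k) , e′) ∷ vs)) (trans (length-replace us vs) l))
      (tally-opened-reset (us ++ (used a (suc k) , e′) ∷ vs))
      (trans (cong (_+ r) (trans (tally-used-reset (us ++ (used a (suc k) , e′) ∷ vs))
                                 (tally-replace #used us {opened a , e} vs)))
        (trans (sym (+-suc _ r)) u))
    where
    valid-reset : ∀ {y} → Valid s (suc k) θ y → Valid s k (suc k) (reset y)
    valid-reset {fresh , _}    (s≤ , _) = s≤ , fresh
    valid-reset {opened _ , _} (s≤ , _) = s≤ , fresh
    valid-reset {used _ _ , _} (s≤ , used a∈ b∈ b<a θ≤b) = s≤ , used a∈ b∈ b<a (≤-trans (<⇒≤ k<θ) θ≤b)
    separate-reset : ∀ x y → Separate (proj₁ x) (proj₁ y) → Separate (proj₁ (reset x)) (proj₁ (reset y))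
    separate-reset (fresh , _)    _              _ = _
    separate-reset (opened _ , _) _              _ = _
    separate-reset (used _ _ , _) (fresh , _)    _ = _
    separate-reset (used _ _ , _) (opened _ , _) _ = _
    separate-reset (used _ _ , _) (used _ _ , _) q = q
    compatible : ∀ {y} → Valid s (suc k) θ y →
                 (Separate (proj₁ y) (opened a) → Separate (proj₁ y) (used a (suc k))) ×
                 (Separate (opened a) (proj₁ y) → Separate (used a (suc k)) (proj₁ y))
    compatible {fresh , _}    _ = _
    compatible {opened _ , _} _ = _
    compatible {used _ _ , _} (_ , used _ _ _ θ≤b) =
      (λ _ → inj₂ (<-≤-trans a<θ θ≤b)) , (λ _ → inj₁ (<-≤-trans a<θ θ≤b))

  twins-of-config : ∀ {k o segs tail} → Config k 0 o segs → ∃[ a ] ∃[ b ] Twins (fill segs tail) {ℓ} a b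
  twins-of-config {segs = segs} (config θ _ valid sep _ _ u) =
    subst (λ L → ∃[ a ] ∃[ b ] Twins (fill segs _) {L} a b)
      (trans (length-pairs segs) (trans (sym (+-identityʳ _)) u))
      (twins-of-pairs (pairs segs) (pairs-descending segs valid) (pairs-apart segs sep)
        (pairs-⊆ proj₁ (λ a∈ _ → a∈) segs valid) (pairs-⊆ proj₂ (λ _ b∈ → b∈) segs valid))

  config-cut : ∀ k xs → m * s ≤ length xs → Config k ℓ 0 (cut s m xs)
  config-cut k xs ms≤ =
    -- No pair exists yet, so the threshold need only exceed the remaining values k, ..., 1.
    config (suc k) (n<1+n k) (valid m xs ms≤) (separate m xs) (len m xs) (none-opened m xs)
      (cong (_+ ℓ) (none-used m xs))
    where
    valid : ∀ m xs → m * s ≤ length xs → All (Valid s k (suc k)) (cut s m xs)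
    valid zero    xs _ = []
    valid (suc m) xs h =
      (≤-reflexive (sym (trans (length-take s xs) (m≤n⇒m⊓n≡m (m+n≤o⇒m≤o s h)))) , fresh) ∷
      valid m (drop s xs) (subst (m * s ≤_) (sym (length-drop s xs))
        (m+n≤o⇒m≤o∸n (m * s) (subst (_≤ length xs) (+-comm s (m * s)) h)))
    separate : ∀ m xs → AllPairs (Separate on proj₁) (cut s m xs)
    separate zero    xs = []
    separate (suc m) xs = All.universal (λ _ → _) _ ∷ separate m (drop s xs)
    len : ∀ m xs → length (cut s m xs) ≡ m
    len zero    xs = refl
    len (suc m) xs = cong suc (len m (drop s xs))
    none-opened : ∀ m xs → tally #opened (cut s m xs) ≡ 0
    none-opened zero    xs = refl
    none-opened (suc m) xs = none-opened m (drop s xs)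
    none-used : ∀ m xs → tally #used (cut s m xs) ≡ 0
    none-used zero    xs = refl
    none-used (suc m) xs = none-used m (drop s xs)

length-fill-inner : ∀ {x : ℕ} us {st st′ e} vs {e′ tail} → e′ ∈ inner x e →
  length (fill (us ++ (st , e′) ∷ vs) tail) ≡ suc (length (fill (us ++ (st′ , e) ∷ vs) tail))
length-fill-inner {x} []       {e = e} vs {e′} e′∈ = trans (length-++ e′)
  (trans (cong (_+ _) (∈-inner-length e e′∈)) (cong suc (sym (length-++ e))))
length-fill-inner {x} ((_ , e₀) ∷ us) vs e′∈ = trans (length-++ e₀)
  (trans (cong (length e₀ +_) (length-fill-inner us vs e′∈))
    (trans (+-suc (length e₀) _) (cong suc (sym (length-++ e₀)))))

length-fill-tail : ∀ {x : ℕ} segs {tail tail′} → tail′ ∈ insertions x tail →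
  length (fill segs tail′) ≡ suc (length (fill segs tail))
length-fill-tail []              tail′∈ = ∈-insertions-length _ tail′∈
length-fill-tail ((_ , e) ∷ segs) tail′∈ = trans (length-++ e)
  (trans (cong (length e +_) (length-fill-tail segs tail′∈))
    (trans (+-suc (length e) _) (cong suc (sym (length-++ e)))))

-- The potential

containsTwins-⊆ : ∀ {Q p p′} → p ⊆ p′ → ContainsTwinsOfLength Q p → ContainsTwinsOfLength Q p′
containsTwins-⊆ i (L , q , a , b , mkTwins ⊆ˡ ⊆ʳ iso disj) =
  L , q , a , b , mkTwins (⊆-trans ⊆ˡ i) (⊆-trans ⊆ʳ i) iso disj

module Process {Q : Pred ℕ 0ℓ} (Q? : Decidable Q) (ℓ m s K F c : ℕ) (Qℓ : Q ℓ) (F+K+ℓ≡m : F + (K + ℓ) ≡ m)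
               (c≤F : c * (4 * K) ≤ s * F) (c≤K : c * (4 * K) ≤ s * (K * K)) where

  open Configurations ℓ m s

  P? : Decidable (ContainsTwinsOfLength Q)
  P? = containsTwinsOfLength? Q?

  misses : List (List ℕ) → ℕ
  misses ps = length (filter (¬? ∘ P?) ps)

  misses-concatMap : ∀ d (f : List ℕ → List (List ℕ)) xs →
                     d * misses (concatMap f xs) ≡ sum (map (λ x → d * misses (f x)) xs)
  misses-concatMap d f []       = *-zeroʳ d
  misses-concatMap d f (x ∷ xs) =
    trans (cong (d *_) (trans (cong length (filter-++ (¬? ∘ P?) (f x) (concatMap f xs)))
                              (length-++ (filter (¬? ∘ P?) (f x)))))
      (trans (*-distribˡ-+ d (misses (f x)) _) (cong (d * misses (f x) +_) (misses-concatMap d f xs)))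

  -- Later insertions only enlarge the list, so twins once formed survive in every extension.
  misses-extensions : ∀ k {p} → ContainsTwinsOfLength Q p → misses (extensions k p) ≡ 0
  misses-extensions k {p} t = cong length (filter-none (¬? ∘ P?) {xs = extensions k p}
    (All.tabulate λ p′∈ ¬t → ¬t (containsTwins-⊆ (extensions-⊇ k p p′∈) t)))

  -- r pairs are missing and h more segments may be opened.  An insertion into a list with N slots
  -- reduces the average of the potential 2 ^ r * (3 * K + h) by the factor 1 - c / N: if h > 0, at least
  -- F segments are fresh, and if h = 0, there are K opened ones.
  misses-bound : ∀ k {r o h segs tail} → o + h ≡ K → Config k r o segs →
    3 * K * misses (extensions k (fill segs tail)) ≤ 2 ^ r * (3 * K + h) * rising c k (length (fill segs tail))
  misses-bound k {zero} {segs = segs} {tail} _ cfg = begin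
    3 * K * misses (extensions k (fill segs tail))
      ≡⟨ cong (3 * K *_) (misses-extensions k (ℓ , Qℓ , twins-of-config cfg)) ⟩
    3 * K * 0 ≡⟨ *-zeroʳ (3 * K) ⟩
    0 ≤⟨ z≤n ⟩
    _ ∎
  -- With no insertion left there is a single list, and the potential is at least `3 * K`.
  misses-bound zero {suc r} {h = h} {segs} {tail} _ cfg = begin
    3 * K * misses [ fill segs tail ]  ≤⟨ *-monoʳ-≤ (3 * K) (length-filter (¬? ∘ P?) [ fill segs tail ]) ⟩
    3 * K * 1                          ≤⟨ *-monoˡ-≤ 1 (≤-trans (m≤m+n (3 * K) h)
                                            (m≤n*m (3 * K + h) (2 ^ suc r) {{m^n≢0 2 (suc r)}})) ⟩
    2 ^ suc r * (3 * K + h) * 1        ∎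
  misses-bound (suc k) {suc r} {o} {h} {segs} {tail} o+h cfg = begin
    3 * K * misses (extensions (suc k) p)
      ≡⟨ misses-concatMap (3 * K) (extensions k) (insertions (suc k) p) ⟩
    sum (map f (insertions (suc k) p))
      ≤⟨ step h o+h cfg ⟩
    (suc (length p) ∸ c) * (2 ^ suc r * (3 * K + h) * R)
      ≡⟨ *-exchange (suc (length p) ∸ c) (2 ^ suc r * (3 * K + h)) R ⟩
    2 ^ suc r * (3 * K + h) * ((suc (length p) ∸ c) * R) ∎
    where
    p = fill segs tail
    R = rising c k (suc (length p))
    W = 2 ^ r
    f : List ℕ → ℕ
    f q = 3 * K * misses (extensions k q)

    -- All lists after one insertion have the same length, so `R` is common to all bounds. The
    -- equation for `q` allows statuses to change while the list stays the same.
    ih : ∀ {r o h segs′ tail′ q} → fill segs′ tail′ ≡ q → length q ≡ suc (length p) → o + h ≡ K →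
         Config k r o segs′ → f q ≤ 2 ^ r * (3 * K + h) * R
    ih {r} {h = h} {q = q} refl len eq cfg =
      subst (λ l → f q ≤ 2 ^ r * (3 * K + h) * rising c k l) len (misses-bound k eq cfg)

    hit-length : ∀ us {st st′ e} vs {e′} → segs ≡ us ++ (st′ , e) ∷ vs → e′ ∈ inner (suc k) e →
                 length (fill (us ++ (st , e′) ∷ vs) tail) ≡ suc (length p)
    hit-length us vs eq e′∈ = trans (length-fill-inner us vs e′∈) (cong (λ ss → suc (length (fill ss tail))) (sym eq))

    hit-keep : ∀ {o h} us {st e} vs {e′} → segs ≡ us ++ (st , e) ∷ vs → e′ ∈ inner (suc k) e → o + h ≡ K →
               Config (suc k) (suc r) o segs → f (fill (us ++ (st , e′) ∷ vs) tail) ≤ 2 ^ suc r * (3 * K + h) * R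
    hit-keep us {st} vs eq e′∈ o+h cfg =
      ih refl (hit-length us {st′ = st} vs eq e′∈) o+h (keep us vs (subst (Config _ _ _) eq cfg) e′∈)

    hit-open : ∀ {o h} us {e} vs {e′} → segs ≡ us ++ (fresh , e) ∷ vs → e′ ∈ inner (suc k) e → suc o + h ≡ K →
               Config (suc k) (suc r) o segs → f (fill (us ++ (fresh , e′) ∷ vs) tail) ≤ 2 ^ suc r * (3 * K + h) * R
    hit-open us vs eq e′∈ o+h cfg =
      ih (fill-restatus us vs) (hit-length us vs eq e′∈) o+h (open-segment us vs (subst (Config _ _ _) eq cfg) e′∈)

    -- One missing pair fewer halves the power of 2, while the reset restores the full allowance h =
    -- K; hence `3 * K + K`.
    hit-close : ∀ {o a} us {e} vs {e′} → segs ≡ us ++ (opened a , e) ∷ vs → e′ ∈ inner (suc k) e →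
                Config (suc k) (suc r) o segs → f (fill (us ++ (opened a , e′) ∷ vs) tail) ≤ W * (3 * K + K) * R
    hit-close us {e} vs {e′} eq e′∈ cfg =
      ih (trans (fill-reset (us ++ (used _ (suc k) , e′) ∷ vs)) (fill-restatus us vs)) (hit-length us vs eq e′∈) refl
        (close-segment us vs (subst (Config _ _ _) eq cfg) e′∈)

    miss-tail : ∀ {o h tail′} → tail′ ∈ insertions (suc k) tail → o + h ≡ K → Config (suc k) (suc r) o segs →
                f (fill segs tail′) ≤ 2 ^ suc r * (3 * K + h) * R
    miss-tail tail′∈ o+h cfg = ih refl (length-fill-tail segs tail′∈) o+h (miss cfg)

    -- A total saving of at least `c * Φ` acts like the removal of `c` slots.
    absorb : ∀ {S G Φ} → S + G ≤ suc (length p) * Φ → c * Φ ≤ G → S ≤ (suc (length p) ∸ c) * Φ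
    absorb {S} {G} {Φ} bound c≤G = subst (S ≤_) (sym (*-distribʳ-∸ Φ (suc (length p)) c))
      (m+n≤o⇒m≤o∸n S (≤-trans (+-monoʳ-≤ S c≤G) bound))

    long : ∀ {o} → Config (suc k) (suc r) o segs → All (λ seg → s ≤ length (proj₂ seg)) segs
    long cfg = All.map proj₁ (Config.valid cfg)

    step : ∀ {o} h → o + h ≡ K → Config (suc k) (suc r) o segs →
           sum (map f (insertions (suc k) p)) ≤ (suc (length p) ∸ c) * (2 ^ suc r * (3 * K + h) * R)
    -- No allowance is left, so all `K` opened segments are present, and closing saves 6WKR - 4WKR =
    -- 2WKR at each of their slots.
    step {o} zero o+h cfg = absorb
      (sum-insertions-≤ segs tail f gain Φ (long cfg) hit (λ t∈ → miss-tail t∈ o+h cfg)) (begin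
      c * Φ                             ≡⟨ lemma₂ c W K R ⟩
      (c * (3 * K)) * (2 * W * R)       ≤⟨ *-monoˡ-≤ (2 * W * R) (≤-trans (*-monoʳ-≤ c (*-monoˡ-≤ K (n≤1+n 3))) c≤K) ⟩
      s * (K * K) * (2 * W * R)         ≡⟨ lemma₃ s W K R ⟩
      s * (K * D)                       ≡⟨ cong (λ x → s * (x * D))
                                            (trans (Config.opened≡ cfg) (trans (sym (+-identityʳ o)) o+h)) ⟨
      s * (tally #opened segs * D)      ≡⟨ cong (s *_) (tally-scale #opened D segs) ⟨
      s * tally gain segs               ∎)
      where
      Φ = 2 ^ suc r * (3 * K + 0) * R
      D = W * (2 * K) * R
      gain : Tally
      gain st = #opened st * D
      lemma₁ : ∀ W K R → W * (3 * K + K) * R + (W * (2 * K) * R + 0) ≡ 2 * W * (3 * K + 0) * R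
      lemma₁ = solve-∀
      lemma₂ : ∀ c W K R → c * (2 * W * (3 * K + 0) * R) ≡ c * (3 * K) * (2 * W * R)
      lemma₂ = solve-∀
      lemma₃ : ∀ s W K R → s * (K * K) * (2 * W * R) ≡ s * (K * (W * (2 * K) * R))
      lemma₃ = solve-∀
      hit : ∀ us {st e} vs {e′} → segs ≡ us ++ (st , e) ∷ vs → e′ ∈ inner (suc k) e →
            f (fill (us ++ (st , e′) ∷ vs) tail) + gain st ≤ Φ
      -- The hit is ignored: without allowance the segment stays fresh.
      hit us {fresh}    vs eq e′∈ = subst (_≤ Φ) (sym (+-identityʳ _)) (hit-keep us vs eq e′∈ o+h cfg)
      hit us {used _ _} vs eq e′∈ = subst (_≤ Φ) (sym (+-identityʳ _)) (hit-keep us vs eq e′∈ o+h cfg)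
      hit us {opened _} vs eq e′∈ = ≤-trans (+-monoˡ-≤ _ (hit-close us vs eq e′∈ cfg)) (≤-reflexive (lemma₁ W K R))
    -- Opening uses up one unit of allowance and saves `D` at each slot of a fresh segment; `Φ` is
    -- at most 4K times `D`, since suc h ≤ K.
    step {o} (suc h) o+h cfg = absorb
      (sum-insertions-≤ segs tail f gain Φ (long cfg) hit (λ t∈ → miss-tail t∈ o+h cfg)) (begin
      c * Φ                             ≡⟨ lemma₂ c W (3 * K + suc h) R ⟩
      c * (3 * K + suc h) * D           ≤⟨ *-monoˡ-≤ D (*-monoʳ-≤ c
                                             (≤-trans (+-monoʳ-≤ (3 * K) (subst (suc h ≤_) o+h (m≤n+m (suc h) o)))
                                               (≤-reflexive (+-comm (3 * K) K)))) ⟩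
      c * (4 * K) * D                   ≤⟨ *-monoˡ-≤ D c≤F ⟩
      s * F * D                         ≤⟨ *-monoˡ-≤ D (*-monoʳ-≤ s F≤fresh) ⟩
      s * tally #fresh segs * D         ≡⟨ *-assoc s _ D ⟩
      s * (tally #fresh segs * D)       ≡⟨ cong (s *_) (tally-scale #fresh D segs) ⟨
      s * tally gain segs               ∎)
      where
      Φ = 2 ^ suc r * (3 * K + suc h) * R
      D = 2 ^ suc r * R
      gain : Tally
      gain st = #fresh st * D
      lemma₁ : ∀ W g h R → 2 * W * (g + h) * R + (2 * W * R + 0) ≡ 2 * W * (g + suc h) * R
      lemma₁ = solve-∀
      lemma₂ : ∀ c W g R → c * (2 * W * g * R) ≡ c * g * (2 * W * R)
      lemma₂ = solve-∀
      lemma₃ : ∀ W K R h → 2 * W * (3 * K + h) * R ≡ W * (3 * K + K) * R + (W * (2 * K) * R + 2 * W * h * R)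
      lemma₃ = solve-∀
      hit : ∀ us {st e} vs {e′} → segs ≡ us ++ (st , e) ∷ vs → e′ ∈ inner (suc k) e →
            f (fill (us ++ (st , e′) ∷ vs) tail) + gain st ≤ Φ
      hit us {fresh}    vs eq e′∈ = ≤-trans (+-monoˡ-≤ _ (hit-open us vs eq e′∈ (trans (sym (+-suc o h)) o+h) cfg))
                                            (≤-reflexive (lemma₁ W (3 * K) h R))
      hit us {used _ _} vs eq e′∈ = subst (_≤ Φ) (sym (+-identityʳ _)) (hit-keep us vs eq e′∈ o+h cfg)
      -- Closing is credited with no saving here; it suffices that 4KW ≤ 2W (3K + suc h).
      hit us {opened _} vs eq e′∈ = subst (_≤ Φ) (sym (+-identityʳ _)) (≤-trans (hit-close us vs eq e′∈ cfg)
        (≤-trans (m≤m+n _ _) (≤-reflexive (sym (lemma₃ W K R (suc h))))))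
      -- Of the F + K + ℓ segments at most `K` are opened and at most `ℓ` are used.
      F≤fresh : F ≤ tally #fresh segs
      F≤fresh = +-cancelʳ-≤ (K + ℓ) F (tally #fresh segs) (begin
        F + (K + ℓ)                ≡⟨ trans F+K+ℓ≡m (trans (sym (Config.length≡ cfg)) (sym (tally-total segs))) ⟩
        tally #fresh segs + (tally #opened segs + tally #used segs)
          ≤⟨ +-monoʳ-≤ (tally #fresh segs) (+-mono-≤
               (subst₂ _≤_ (sym (Config.opened≡ cfg)) o+h (m≤m+n o (suc h)))
               (subst (tally #used segs ≤_) (Config.used≡ cfg) (m≤m+n _ (suc r)))) ⟩
        tally #fresh segs + (K + ℓ) ∎)

  -- Initially r = ℓ and h = K, so the potential is 2^ℓ · 4K. The decay by 4^ℓ leaves a proportion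
  -- of misses of at most 4/3 · 2^(-ℓ), and 4/3 is rounded up to 2.
  misses-extensions-≤ : .{{_ : NonZero K}} → ∀ {n} .{{_ : NonZero n}} t p → m * s ≤ length p →
    length p + t * ℓ ≤ n → 3 * n ≤ t * c →
    misses (extensions (t * ℓ) p) * 2 ^ ℓ ≤ 2 * length (extensions (t * ℓ) p)
  misses-extensions-≤ t p ms≤ ≤n 3n≤ = *-cancelˡ-≤ 2 (*-cancelˡ-≤ (Z * K) {{m*n≢0 Z K {{m^n≢0 2 ℓ}}}} (begin
    Z * K * (2 * (x * Z))     ≤⟨ *-monoʳ-≤ (Z * K) (*-monoˡ-≤ (x * Z) (n≤1+n 2)) ⟩
    Z * K * (3 * (x * Z))     ≡⟨ lemma₁ Z K x ⟩
    3 * K * x * (Z * Z)       ≡⟨ cong (3 * K * x *_) (^-distribʳ-* ℓ 2 2) ⟨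
    3 * K * x * 4 ^ ℓ         ≤⟨ *-monoˡ-≤ (4 ^ ℓ) bound ⟩
    Z * (3 * K + K) * R * 4 ^ ℓ ≡⟨ *-assoc (Z * (3 * K + K)) R (4 ^ ℓ) ⟩
    Z * (3 * K + K) * (R * 4 ^ ℓ) ≤⟨ *-monoʳ-≤ (Z * (3 * K + K)) (rising-gain c t ℓ (length p) ≤n 3n≤) ⟩
    Z * (3 * K + K) * rising 0 (t * ℓ) (length p) ≡⟨ cong (Z * (3 * K + K) *_) (length-extensions (t * ℓ) p) ⟨
    Z * (3 * K + K) * y       ≡⟨ lemma₂ Z K y ⟩
    Z * K * (2 * (2 * y))     ∎))
    where
    Z = 2 ^ ℓ
    x = misses (extensions (t * ℓ) p)
    y = length (extensions (t * ℓ) p)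
    R = rising c (t * ℓ) (length p)
    bound : 3 * K * x ≤ Z * (3 * K + K) * R
    bound = subst (λ q → 3 * K * misses (extensions (t * ℓ) q) ≤ Z * (3 * K + K) * rising c (t * ℓ) (length q))
              (fill-cut s m p)
              (misses-bound (t * ℓ) refl (config-cut (t * ℓ) p ms≤))
    lemma₁ : ∀ Z K x → Z * K * (3 * (x * Z)) ≡ 3 * K * x * (Z * Z)
    lemma₁ = solve-∀
    lemma₂ : ∀ Z K y → Z * (3 * K + K) * y ≡ Z * K * (2 * (2 * y))
    lemma₂ = solve-∀

  misses-concatMap-≤ : ∀ d e (f : List ℕ → List (List ℕ)) xs →
                       (∀ {x} → x ∈ xs → misses (f x) * d ≤ e * length (f x)) →
                       misses (concatMap f xs) * d ≤ e * length (concatMap f xs)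
  misses-concatMap-≤ d e f []       h = z≤n
  misses-concatMap-≤ d e f (x ∷ xs) h = begin
    misses (f x ++ concatMap f xs) * d
      ≡⟨ cong (_* d) (trans (cong length (filter-++ (¬? ∘ P?) (f x) (concatMap f xs)))
                          (length-++ (filter (¬? ∘ P?) (f x)))) ⟩
    (misses (f x) + misses (concatMap f xs)) * d
      ≡⟨ *-distribʳ-+ d (misses (f x)) _ ⟩
    misses (f x) * d + misses (concatMap f xs) * d
      ≤⟨ +-mono-≤ (h (here refl)) (misses-concatMap-≤ d e f xs (h ∘ there)) ⟩
    e * length (f x) + e * length (concatMap f xs)
      ≡⟨ *-distribˡ-+ e (length (f x)) _ ⟨
    e * (length (f x) + length (concatMap f xs))
      ≡⟨ cong (e *_) (length-++ (f x)) ⟨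
    e * length (f x ++ concatMap f xs) ∎

  -- This conditions on the order of the `n ∸ t * ℓ` largest values: the bound holds for every such
  -- base list and is preserved by summation.
  misses-permutations-≤ : .{{_ : NonZero K}} → ∀ {n} .{{_ : NonZero n}} t → m * s + t * ℓ ≤ n → 3 * n ≤ t * c →
    misses (permutations [1⋯ n ]) * 2 ^ ℓ ≤ 2 * length (permutations [1⋯ n ])
  misses-permutations-≤ {n} t ms≤ 3n≤ =
    subst (λ ps → misses ps * 2 ^ ℓ ≤ 2 * length ps)
      (trans (sym (permutations-interval (t * ℓ) j))
        (cong permutations (trans (cong (interval 0) T+j≡n) (sym ([1⋯]-interval n)))))
      (misses-concatMap-≤ (2 ^ ℓ) 2 (extensions (t * ℓ)) (permutations base) λ {p} p∈ →
        misses-extensions-≤ t p (subst (m * s ≤_) (sym (len p∈)) (m+n≤o⇒m≤o∸n (m * s) ms≤))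
          (≤-reflexive (trans (cong (_+ t * ℓ) (len p∈)) (trans (+-comm j (t * ℓ)) T+j≡n))) 3n≤)
    where
    j = n ∸ t * ℓ
    base = interval (t * ℓ) j
    T+j≡n : t * ℓ + j ≡ n
    T+j≡n = m+[n∸m]≡n (m+n≤o⇒n≤o (m * s) ms≤)
    len : ∀ {p} → p ∈ permutations base → length p ≡ j
    len p∈ = trans (↭-length (Equivalence.to (∈-permutations⇔↭ base) p∈)) (length-interval (t * ℓ) j)

-- Choice of parameters and passage to the limit

length-filter-complement : ∀ {P : Pred A 0ℓ} (P? : Decidable P) xs →
                           length (filter P? xs) + length (filter (¬? ∘ P?) xs) ≡ length xs
length-filter-complement P? []       = refl
length-filter-complement P? (x ∷ xs) with P? x
... | yes _ = cong suc (length-filter-complement P? xs)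
... | no  _ = trans (+-suc _ _) (cong suc (length-filter-complement P? xs))

-- For n close to (8 q)³: there is room for 17 q² + 4 q segments of length 8 q and 256 q³ later insertions.
few-misses : ∀ n q → 20 ≤ q → (8 * q) ^ 3 ≤ n → n ≤ (8 * suc q) ^ 3 →
  length (filter (¬? ∘ containsTwinsOfLength? (λ L → n ^ 2 ≤? (80 * L) ^ 3)) (permutations [1⋯ n ])) * 2 ^ (q * q)
    ≤ 2 * length (permutations [1⋯ n ])
few-misses n q 20≤q ≤n n≤ =
  Process.misses-permutations-≤ (λ L → n ^ 2 ≤? (80 * L) ^ 3)
    -- In the order `ℓ m s K F c`. With c = 8q² both conditions on `c` are equalities, all sides
    -- being 128 q³.
    (q * q) (16 * (q * q) + (4 * q + q * q)) (8 * q) (4 * q) (16 * (q * q)) (8 * (q * q))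
    (length-enough 20≤q n≤) refl (≤-reflexive (budget₁ q)) (≤-reflexive (budget₂ q))
    {{m*n≢0 4 q}} {{n≢0}} (256 * q) (room-enough ≤n) (steps-enough 20≤q n≤)
  where
  instance
    q≢0 : NonZero q
    q≢0 = >-nonZero (≤-trans (s≤s z≤n) 20≤q)
  n≢0 : NonZero n
  n≢0 = >-nonZero (≤-trans (m^n>0 (8 * q) {{m*n≢0 8 q}} 3) ≤n)
  budget₁ : ∀ q → 8 * (q * q) * (4 * (4 * q)) ≡ 8 * q * (16 * (q * q))
  budget₁ = solve-∀
  budget₂ : ∀ q → 8 * (q * q) * (4 * (4 * q)) ≡ 8 * q * (4 * q * (4 * q))
  budget₂ = solve-∀

Pr-twins-near-1 : ∀ n q ε → 0ℚ ℚ.< ε → 20 ≤ q → 4 * ℚ.↧ₙ ε ≤ q → (8 * q) ^ 3 ≤ n → n ≤ (8 * suc q) ^ 3 →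
  ℚ.∣ Pr n (containsTwinsOfLength? (λ L → n ^ 2 ≤? (80 * L) ^ 3)) ℚ.- 1ℚ ∣ ℚ.< ε
Pr-twins-near-1 n q ε ε>0 20≤q 4b≤q ≤n n≤ =
  ratio-near-1 (length (filter P? 𝕊)) x (length 𝕊) {{𝕊≢0}} ε ε>0 (length-filter-complement P? 𝕊)
    (small-ratio x (length 𝕊) (ℚ.↧ₙ ε) q {{𝕊≢0}} {{q≢0}} 4b≤q (few-misses n q 20≤q ≤n n≤))
  where
  P? = containsTwinsOfLength? (λ L → n ^ 2 ≤? (80 * L) ^ 3)
  𝕊 = permutations [1⋯ n ]
  x = length (filter (¬? ∘ P?) 𝕊)
  𝕊≢0 = permutations-nonEmpty [1⋯ n ]
  q≢0 = >-nonZero (≤-trans (s≤s z≤n) 20≤q)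

theorem2 : (λ n → Pr n (containsTwinsOfLength? (λ L → n ^ 2 ≤? (80 * L) ^ 3))) ⟶ 1ℚ
theorem2 ε ε>0 = (8 * q₀) ^ 3 , λ n N≤n →
  let q , q₀≤q , ≤n , n≤ = cube-scale 8 q₀ n N≤n in
  Pr-twins-near-1 n q ε ε>0 (≤-trans (m≤m+n 20 (4 * ℚ.↧ₙ ε)) q₀≤q) (≤-trans (m≤n+m (4 * ℚ.↧ₙ ε) 20) q₀≤q) ≤n n≤
  where
  -- The 20 serves `square-step` and `cube-step`; the multiple of the denominator serves
  -- `small-ratio`.
  q₀ = 20 + 4 * ℚ.↧ₙ ε
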